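{- The maximum values $f^+(n,\delta)$ and minimum values $f^-(n,\delta)$ satisfy the following, as $n \to \infty$. (a) For each $0<\delta<1$ there are constants $c_1(\delta)$ and $c_2(\delta)$ such that \[0< c_1(\delta) < \left( \frac{f^+(n,\delta)}{n!} \right)^{1/n} < c_2(\delta) <1 \quad \mbox{ for } n \mbox{ sufficiently large};\] and further, $c_1(\delta) \to 1$ as $\delta \to 0$, and $c_2(\delta) \to 0$ as $\delta \to 1$. (b) For each $0<\delta<1$ there are constants $c_3(\delta)$ and $c_4(\delta)$ such that \[1 < c_3(\delta) < f^-(n,\delta)^{1/n} < c_4(\delta) < \infty \quad \mbox{ for } n \mbox{ sufficiently large};\] and further, $c_3(\delta) \to \infty$ as $\delta \to 0$, and $c_4(\delta) \to 1$ as $\delta \to 1$.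
   Context: For a finite poset $Q_n$ on $n$ points, $e(Q_n)$ denotes its number of linear extensions and $\mathrm{comp}(Q_n)$ denotes the number of edges in its comparability graph (the number of comparable pairs). For a positive integer $n$ and $0<\delta<1$, \[ f^+(n,\delta)= \max \left\{ e(Q_n): \mathrm{comp}(Q_n) \geq \delta \binom{n}{2} \right\}, \quad f^-(n,\delta)= \min \left\{ e(Q_n): \mathrm{comp}(Q_n) \leq \delta \binom{n}{2} \right\}. \]
   Formalization: The density δ ranges over the rational numbers in (0,1) instead of the reals, and the limits as δ → 0 and δ → 1 are taken over rational δ; the constants c₁(δ), …, c₄(δ) are obtained as rational numbers. -}

module Defs where

open import Data.Bool.Base using (Bool; true; false; if_then_else_; _∧_; _∨_; not)
open import Data.Nat.Base using (ℕ; zero; suc; _+_)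
import Data.Nat.Base as ℕ
open import Data.Nat.Properties using (_<?_)
open import Data.Fin.Base using (Fin; toℕ)
open import Data.Fin.Properties using (_≟_)
open import Data.List.Base using (List; []; _∷_; [_]; map; concatMap; length; filterᵇ; allFin)
open import Data.Vec.Functional using (Vector) renaming (_∷_ to _◂_)
open import Data.Integer.Base using (+_)
open import Data.Rational.Base using (ℚ; _*_; 1ℚ) renaming (_/_ to _÷_)
open import Relation.Nullary.Decidable using (⌊_⌋)
open import Relation.Binary.PropositionalEquality using (_≡_)

-- A finite poset on the n points Fin n, given by its strict order relation
-- (decidable, Bool-valued); irreflexive + transitive (asymmetry follows).
record Poset (n : ℕ) : Set where
  field
    lt     : Fin n → Fin n → Bool
    irrefl : ∀ i → lt i i ≡ false
    trans  : ∀ i j k → lt i j ≡ true → lt j k ≡ true → lt i k ≡ true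
open Poset public

sumFin : (n : ℕ) → (Fin n → ℕ) → ℕ
sumFin zero    f = 0
sumFin (suc n) f = f Fin.zero + sumFin n (λ i → f (Fin.suc i))
  where import Data.Fin.Base as Fin

comp : ∀ {n} → Poset n → ℕ
comp {n} P = sumFin n (λ i → sumFin n (λ j → if lt P i j then 1 else 0))

allFuns : (n k : ℕ) → List (Vector (Fin k) n)
allFuns zero    k = [ (λ ()) ]
allFuns (suc n) k = concatMap (λ f → map (λ a → a ◂ f) (allFin k)) (allFuns n k)

allB : {A : Set} → (A → Bool) → List A → Bool
allB p []       = true
allB p (x ∷ xs) = p x ∧ allB p xs

-- σ : Fin n → Fin n (point ↦ position) is a linear extension of P:
-- σ is injective (hence a bijection) and i <_P j implies σ i < σ j.
isLinExt : ∀ {n} → Poset n → (Fin n → Fin n) → Bool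
isLinExt {n} P σ =
  allB (λ i → allB (λ j →
        (⌊ i ≟ j ⌋ ∨ not ⌊ σ i ≟ σ j ⌋)
      ∧ (not (lt P i j) ∨ ⌊ toℕ (σ i) <? toℕ (σ j) ⌋)) (allFin n)) (allFin n)

e : ∀ {n} → Poset n → ℕ
e {n} P = length (filterᵇ (isLinExt P) (allFuns n n))

ℕtoℚ : ℕ → ℚ
ℕtoℚ m = (+ m) ÷ 1

_^ℚ_ : ℚ → ℕ → ℚ
q ^ℚ zero  = 1ℚ
q ^ℚ suc m = q * (q ^ℚ m)

choose2 : ℕ → ℕ
choose2 zero    = 0
choose2 (suc n) = n + choose2 n

{-# OPTIONS --safe #-}
module Submission where

-- Everything rests on e(P) = Σ e(P − x), summed over the minimal points x. By induction on n it gives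
--   (1) n! ≤ e(P) ∏ᵢ |up-set of i|;
--   (2) e(P) ≤ ∏ᵢ (1 + number of later points incomparable to i), an equality for weak orders;
--   (3) e(P) ∏ᵢ w(i) ≤ 1 if P is partitioned into chains and the weights w are constant on each
--       chain, with total at most 1 over the chains.
-- In (1), listed along a linear extension, and in (2) the i-th factor is at most n − i, while the
-- factors sum to at most n + x C(n,2), where x = δ in (1) and x = 1 − δ in (2). By AM–GM their
-- product is at most about (√x)ⁿ n!, which gives c₃ = 1/g(δ) and c₂ = g(1 − δ) with g(x) ≈ √x.
-- For c₄ take disjoint chains P: residue classes modulo r when δ is not close to 1, and otherwise two
-- chains, the smaller one consisting of the multiples of t², where t² ≈ 1/(1 − δ); (3) bounds e(P).
-- The weak order Q whose levels are these chains has comp(Q) = C(n,2) − comp(P), and by (1) and (2)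
-- e(P) e(Q) ≥ n!, so Q gives c₁(δ) = 1/c₄(1 − δ).

open import Defs

-- Applying AM-GM directly to the factors dᵢ of (1) and (2) would bound (∏ dᵢ / n!)^(1/n) only by
-- about 1.36 x, half of Euler's number times x. This exceeds 1 for x near 1, whereas c₂ < 1 < c₃ is
-- wanted for every δ. So the cap dᵢ ≤ n - i has to enter, and AM-GM is applied to linear majorants
-- of the ratios dᵢ / (n - i). The majorants depend on a parameter t > 0 and have average about (t x
-- + 1/t) / 2, which is least at t = 1/√x, with value √x. An integer t close to 1/√x is good enough,
-- and then, with δ = u / r, every estimate is an inequality between natural numbers: n-th roots
-- become n-th powers, a maximum or minimum becomes one example together with a bound for all
-- posets, and division appears only in the final translation to ℚ. A second constraint is that comp
-- must respect δ C(n,2) exactly, not just asymptotically. The chains are therefore chosen so that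
-- their densities are right on every initial segment of the points.

module Counting where

  open import Data.Bool.Base as Bool using (Bool; true; false; if_then_else_; _∧_; _∨_; not)
  open import Data.Bool.Properties as Bool using (¬-not)
  open import Data.Fin.Base using (Fin; zero; suc; toℕ; fromℕ<; punchIn; punchOut)
  open import Data.Fin.Induction using (spo-wellFounded)
  open import Data.Fin.Properties as Fin using (_≟_; all?; any?; ¬∀⟶∃¬; punchIn-punchOut; punchInᵢ≢i; punchIn-injective; punchOut-injective; <⇒notInjective; toℕ-injective; toℕ<n; toℕ-fromℕ<)
  open import Data.List.Base using (List; []; _∷_; _++_; map; concatMap; length; filterᵇ; allFin; tabulate)
  open import Data.Nat.Base
  open import Data.Nat.DivMod using (_%_; _/_; m≡m%n+[m/n]*n; m%n<n; m<n⇒m%n≡m; [m+n]%n≡m%n)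
  open import Data.Nat.Properties hiding (_≟_)
  open import Data.Nat.Tactic.RingSolver using (solve-∀)
  open import Data.Product using (Σ; _×_; _,_; ∃; proj₁; proj₂)
  open import Data.Sum.Base using (_⊎_; inj₁; inj₂)
  open import Data.Unit.Base using (tt)
  open import Data.Vec.Functional using (insertAt) renaming (_∷_ to _◂_)
  open import Data.Vec.Functional.Properties using (insertAt-lookup; insertAt-punchIn)
  open import Function.Base using (_∘_)
  open import Induction.WellFounded using (Acc; acc)
  open import Relation.Binary.Definitions using (Tri; tri<; tri≈; tri>)
  open import Relation.Binary.PropositionalEquality as ≡ using (_≡_; _≢_; _≗_; refl; sym; cong; cong₂; subst; module ≡-Reasoning)
  open import Relation.Binary.Structures using (IsStrictPartialOrder)
  open import Relation.Nullary using (¬_; Dec; yes; no; contradiction)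
  open import Relation.Nullary.Decidable using (⌊_⌋)
  open import Algebra.Properties.CommutativeSemigroup +-commutativeSemigroup using () renaming (interchange to +-interchange; x∙yz≈y∙xz to +-left-comm)
  open import Algebra.Properties.CommutativeSemigroup *-commutativeSemigroup using () renaming (interchange to *-interchange; x∙yz≈y∙xz to *-left-comm)

  -- Truth values as the numbers 0 and 1

  ⟦_⟧ : Bool → ℕ
  ⟦ b ⟧ = if b then 1 else 0

  ⟦∧⟧ : ∀ a b → ⟦ a ∧ b ⟧ ≡ ⟦ a ⟧ * ⟦ b ⟧
  ⟦∧⟧ true  true  = refl
  ⟦∧⟧ true  false = refl
  ⟦∧⟧ false b     = refl

  ⟦⟧≤1 : ∀ b → ⟦ b ⟧ ≤ 1
  ⟦⟧≤1 true  = ≤-refl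
  ⟦⟧≤1 false = z≤n

  ≡true-ext : ∀ {a b} → (a ≡ true → b ≡ true) → (b ≡ true → a ≡ true) → a ≡ b
  ≡true-ext {true}  {b}     f g = sym (f refl)
  ≡true-ext {false} {true}  f g = g refl
  ≡true-ext {false} {false} f g = refl

  ∧-true : ∀ {a b} → a ∧ b ≡ true → a ≡ true × b ≡ true
  ∧-true {true} {true} refl = refl , refl

  ⌊⌋-true⁻ : ∀ {A : Set} (a? : Dec A) → ⌊ a? ⌋ ≡ true → A
  ⌊⌋-true⁻ (yes a) _ = a

  ⌊⌋-true : ∀ {A : Set} (a? : Dec A) → A → ⌊ a? ⌋ ≡ true
  ⌊⌋-true (yes _) a = refl
  ⌊⌋-true (no ¬a) a = contradiction a ¬a

  ⌊⌋-false : ∀ {A : Set} (a? : Dec A) → ¬ A → ⌊ a? ⌋ ≡ false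
  ⌊⌋-false (yes a) ¬a = contradiction a ¬a
  ⌊⌋-false (no _)  ¬a = refl

  -- Finite sums and products

  sum-cong : ∀ n {f g : Fin n → ℕ} → f ≗ g → sumFin n f ≡ sumFin n g
  sum-cong zero    f≗g = refl
  sum-cong (suc n) f≗g = cong₂ _+_ (f≗g zero) (sum-cong n (f≗g ∘ suc))

  sum-mono : ∀ n {f g : Fin n → ℕ} → (∀ i → f i ≤ g i) → sumFin n f ≤ sumFin n g
  sum-mono zero    f≤g = z≤n
  sum-mono (suc n) f≤g = +-mono-≤ (f≤g zero) (sum-mono n (f≤g ∘ suc))

  sum-zero : ∀ n → sumFin n (λ _ → 0) ≡ 0
  sum-zero zero    = refl
  sum-zero (suc n) = sum-zero n

  sum-const : ∀ n c → sumFin n (λ _ → c) ≡ n * c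
  sum-const zero    c = refl
  sum-const (suc n) c = cong (c +_) (sum-const n c)

  sum-+ : ∀ n (f g : Fin n → ℕ) → sumFin n (λ i → f i + g i) ≡ sumFin n f + sumFin n g
  sum-+ zero    f g = refl
  sum-+ (suc n) f g = ≡.trans (cong (f zero + g zero +_) (sum-+ n (f ∘ suc) (g ∘ suc)))
                              (+-interchange (f zero) (g zero) _ _)

  sum-*ˡ : ∀ n c (f : Fin n → ℕ) → sumFin n (λ i → c * f i) ≡ c * sumFin n f
  sum-*ˡ zero    c f = sym (*-zeroʳ c)
  sum-*ˡ (suc n) c f = ≡.trans (cong (c * f zero +_) (sum-*ˡ n c (f ∘ suc))) (sym (*-distribˡ-+ c (f zero) _))

  sum-*ʳ : ∀ n c (f : Fin n → ℕ) → sumFin n (λ i → f i * c) ≡ sumFin n f * c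
  sum-*ʳ n c f = ≡.trans (sum-cong n (λ i → *-comm (f i) c)) (≡.trans (sum-*ˡ n c f) (*-comm c _))

  sum-swap : ∀ m n (f : Fin m → Fin n → ℕ) →
             sumFin m (λ i → sumFin n (f i)) ≡ sumFin n (λ j → sumFin m (λ i → f i j))
  sum-swap zero    n f = sym (sum-zero n)
  sum-swap (suc m) n f = ≡.trans (cong (sumFin n (f zero) +_) (sum-swap m n (f ∘ suc)))
                                 (sym (sum-+ n (f zero) _))

  sum-punchIn : ∀ n (i : Fin (suc n)) (f : Fin (suc n) → ℕ) →
                sumFin (suc n) f ≡ f i + sumFin n (f ∘ punchIn i)
  sum-punchIn n       zero    f = refl
  sum-punchIn (suc n) (suc i) f = ≡.trans (cong (f zero +_) (sum-punchIn n i (f ∘ suc)))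
                                          (+-left-comm (f zero) (f (suc i)) _)

  term≤sum : ∀ n (i : Fin n) (f : Fin n → ℕ) → f i ≤ sumFin n f
  term≤sum (suc n) i f = ≤-trans (m≤m+n (f i) _) (≤-reflexive (sym (sum-punchIn n i f)))

  sum-single : ∀ n (i : Fin n) (f : Fin n → ℕ) → (∀ j → j ≢ i → f j ≡ 0) → sumFin n f ≡ f i
  sum-single (suc n) i f f≡0 = begin
    sumFin (suc n) f                       ≡⟨ sum-punchIn n i f ⟩
    f i + sumFin n (f ∘ punchIn i)         ≡⟨ cong (f i +_) (sum-cong n (λ j → f≡0 _ (punchInᵢ≢i i j))) ⟩
    f i + sumFin n (λ _ → 0)               ≡⟨ cong (f i +_) (sum-zero n) ⟩
    f i + 0                                ≡⟨ +-identityʳ (f i) ⟩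
    f i                                    ∎
    where open ≡-Reasoning

  prodFin : (n : ℕ) → (Fin n → ℕ) → ℕ
  prodFin zero    f = 1
  prodFin (suc n) f = f zero * prodFin n (f ∘ suc)

  prod-cong : ∀ n {f g : Fin n → ℕ} → f ≗ g → prodFin n f ≡ prodFin n g
  prod-cong zero    f≗g = refl
  prod-cong (suc n) f≗g = cong₂ _*_ (f≗g zero) (prod-cong n (f≗g ∘ suc))

  prod-mono : ∀ n {f g : Fin n → ℕ} → (∀ i → f i ≤ g i) → prodFin n f ≤ prodFin n g
  prod-mono zero    f≤g = ≤-refl
  prod-mono (suc n) f≤g = *-mono-≤ (f≤g zero) (prod-mono n (f≤g ∘ suc))

  prod-punchIn : ∀ n (i : Fin (suc n)) (f : Fin (suc n) → ℕ) →
                 prodFin (suc n) f ≡ f i * prodFin n (f ∘ punchIn i)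
  prod-punchIn n       zero    f = refl
  prod-punchIn (suc n) (suc i) f = ≡.trans (cong (f zero *_) (prod-punchIn n i (f ∘ suc)))
                                           (*-left-comm (f zero) (f (suc i)) _)

  prod-zero : ∀ n (i : Fin n) (f : Fin n → ℕ) → f i ≡ 0 → prodFin n f ≡ 0
  prod-zero (suc n) i f fi≡0 = ≡.trans (prod-punchIn n i f) (cong (_* prodFin n (f ∘ punchIn i)) fi≡0)

  -- Sums over all functions Fin n → Fin k

  sumFun : ∀ n k → ((Fin n → Fin k) → ℕ) → ℕ
  sumFun zero    k g = g (λ ())
  sumFun (suc n) k g = sumFun n k (λ f → sumFin k (λ a → g (a ◂ f)))

  -- Functions built in different ways, such as `a ◂ f` and `insertAt f zero a`, agree only
  -- pointwise, so a change of summation variable needs a summand that respects `≗`.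
  Extensional : ∀ {n k} → ((Fin n → Fin k) → ℕ) → Set
  Extensional g = ∀ {f f′} → f ≗ f′ → g f ≡ g f′

  ◂-cong : ∀ {n k} (a : Fin k) {f f′ : Fin n → Fin k} → f ≗ f′ → (a ◂ f) ≗ (a ◂ f′)
  ◂-cong a f≗f′ zero    = refl
  ◂-cong a f≗f′ (suc i) = f≗f′ i

  sumFun-cong : ∀ n k {g g′ : (Fin n → Fin k) → ℕ} → g ≗ g′ → sumFun n k g ≡ sumFun n k g′
  sumFun-cong zero    k g≗g′ = g≗g′ _
  sumFun-cong (suc n) k g≗g′ = sumFun-cong n k (λ f → sum-cong k (λ a → g≗g′ (a ◂ f)))

  sumFun-sum : ∀ n k m (g : Fin m → (Fin n → Fin k) → ℕ) →
               sumFun n k (λ f → sumFin m (λ i → g i f)) ≡ sumFin m (λ i → sumFun n k (g i))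
  sumFun-sum zero    k m g = refl
  sumFun-sum (suc n) k m g = ≡.trans
    (sumFun-cong n k (λ f → sum-swap k m (λ a i → g i (a ◂ f))))
    (sumFun-sum n k m (λ i f → sumFin k (λ a → g i (a ◂ f))))

  sumFun-*ˡ : ∀ n k c (g : (Fin n → Fin k) → ℕ) → sumFun n k (λ f → c * g f) ≡ c * sumFun n k g
  sumFun-*ˡ zero    k c g = refl
  sumFun-*ˡ (suc n) k c g = ≡.trans
    (sumFun-cong n k (λ f → sum-*ˡ k c (λ a → g (a ◂ f))))
    (sumFun-*ˡ n k c _)

  -- Makes the value at an arbitrary point `i` the innermost summation variable. `e-suc` uses it to
  -- single out the point in first position.
  sumFun-insertAt : ∀ n k (i : Fin (suc n)) (g : (Fin (suc n) → Fin k) → ℕ) → Extensional g →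
    sumFun (suc n) k g ≡ sumFun n k (λ f → sumFin k (λ a → g (insertAt f i a)))
  sumFun-insertAt n k zero g ext = sumFun-cong n k (λ f → sum-cong k (λ a → ext (◂≗insertAt f a)))
    where
    ◂≗insertAt : ∀ f a → (a ◂ f) ≗ insertAt f zero a
    ◂≗insertAt f a zero    = refl
    ◂≗insertAt f a (suc j) = refl
  sumFun-insertAt (suc n) k (suc i) g ext = ≡.trans
    (sumFun-insertAt n k i (λ f → sumFin k (λ a → g (a ◂ f))) (λ f≗f′ → sum-cong k (λ a → ext (◂-cong a f≗f′))))
    (sumFun-cong n k (λ f → ≡.trans (sum-swap k k (λ b a → g (a ◂ insertAt f i b)))
      (sum-cong k (λ a → sum-cong k (λ b → ext (◂-insertAt f a b))))))
    where
    ◂-insertAt : ∀ f a b → (a ◂ insertAt f i b) ≗ insertAt (a ◂ f) (suc i) b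
    ◂-insertAt f a b zero    = refl
    ◂-insertAt f a b (suc j) = refl

  -- Only functions that avoid zero contribute, and these are exactly the `suc ∘ f`.
  sumFun-suc : ∀ n k (g : (Fin n → Fin (suc k)) → ℕ) → Extensional g →
    (∀ f j → f j ≡ zero → g f ≡ 0) → sumFun n (suc k) g ≡ sumFun n k (λ f → g (suc ∘ f))
  sumFun-suc zero    k g ext g≡0 = ext (λ ())
  sumFun-suc (suc n) k g ext g≡0 = ≡.trans
    (sumFun-cong n (suc k) (λ f → cong (_+ sumFin k (λ a → g (suc a ◂ f))) (g≡0 (zero ◂ f) zero refl)))
    (≡.trans
      (sumFun-suc n k (λ f → sumFin k (λ a → g (suc a ◂ f)))
        (λ f≗f′ → sum-cong k (λ a → ext (◂-cong (suc a) f≗f′)))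
        (λ f j fj≡0 → ≡.trans (sum-cong k (λ a → g≡0 (suc a ◂ f) (suc j) fj≡0)) (sum-zero k)))
      (sumFun-cong n k (λ f → sum-cong k (λ a → ext (◂-suc f a)))))
    where
    ◂-suc : ∀ f a → (suc a ◂ (suc ∘ f)) ≗ (suc ∘ (a ◂ f))
    ◂-suc f a zero    = refl
    ◂-suc f a (suc j) = refl

  -- The list enumeration behind `e` as a sum over functions

  sumList : {A : Set} → (A → ℕ) → List A → ℕ
  sumList g []       = 0
  sumList g (x ∷ xs) = g x + sumList g xs

  sumList-++ : ∀ {A : Set} g (xs ys : List A) → sumList g (xs ++ ys) ≡ sumList g xs + sumList g ys
  sumList-++ g []       ys = refl
  sumList-++ g (x ∷ xs) ys = ≡.trans (cong (g x +_) (sumList-++ g xs ys)) (sym (+-assoc (g x) _ _))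

  sumList-map-tabulate : ∀ {A B : Set} n (g : A → ℕ) (m : B → A) (h : Fin n → B) →
                         sumList g (map m (tabulate h)) ≡ sumFin n (λ i → g (m (h i)))
  sumList-map-tabulate zero    g m h = refl
  sumList-map-tabulate (suc n) g m h = cong (g (m (h zero)) +_) (sumList-map-tabulate n g m (h ∘ suc))

  sumList-concatMap : ∀ {A B : Set} g (h : A → List B) xs →
                      sumList g (concatMap h xs) ≡ sumList (λ x → sumList g (h x)) xs
  sumList-concatMap g h []       = refl
  sumList-concatMap g h (x ∷ xs) = ≡.trans (sumList-++ g (h x) (concatMap h xs))
                                           (cong (sumList g (h x) +_) (sumList-concatMap g h xs))

  sumList-cong : ∀ {A : Set} {g g′ : A → ℕ} → g ≗ g′ → ∀ xs → sumList g xs ≡ sumList g′ xs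
  sumList-cong g≗g′ []       = refl
  sumList-cong g≗g′ (x ∷ xs) = cong₂ _+_ (g≗g′ x) (sumList-cong g≗g′ xs)

  sumList-allFuns : ∀ n k g → sumList g (allFuns n k) ≡ sumFun n k g
  sumList-allFuns zero    k g = +-identityʳ _
  sumList-allFuns (suc n) k g = begin
    sumList g (allFuns (suc n) k)
      ≡⟨ sumList-concatMap g (λ f → map (λ a → a ◂ f) (allFin k)) (allFuns n k) ⟩
    sumList (λ f → sumList g (map (λ a → a ◂ f) (allFin k))) (allFuns n k)
      ≡⟨ sumList-cong (λ f → sumList-map-tabulate k g (λ a → a ◂ f) (λ a → a)) (allFuns n k) ⟩
    sumList (λ f → sumFin k (λ a → g (a ◂ f))) (allFuns n k)
      ≡⟨ sumList-allFuns n k _ ⟩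
    sumFun n k (λ f → sumFin k (λ a → g (a ◂ f))) ∎
    where open ≡-Reasoning

  length-filterᵇ≡sumList : ∀ {A : Set} (p : A → Bool) xs → length (filterᵇ p xs) ≡ sumList (⟦_⟧ ∘ p) xs
  length-filterᵇ≡sumList p []       = refl
  length-filterᵇ≡sumList p (x ∷ xs) with p x
  ... | true  = cong suc (length-filterᵇ≡sumList p xs)
  ... | false = length-filterᵇ≡sumList p xs

  e≡sumFun : ∀ {n} (P : Poset n) → e P ≡ sumFun n n (λ σ → ⟦ isLinExt P σ ⟧)
  e≡sumFun {n} P = ≡.trans (length-filterᵇ≡sumList (isLinExt P) (allFuns n n)) (sumList-allFuns n n _)

  -- Removing a minimal point

  record LinExt {n k} (P : Poset n) (σ : Fin n → Fin k) : Set where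
    constructor linExt
    field
      injective : ∀ i j → σ i ≡ σ j → i ≡ j
      monotone  : ∀ i j → lt P i j ≡ true → toℕ (σ i) < toℕ (σ j)

  allB-tabulate⁻ : ∀ {A : Set} n (p : A → Bool) (h : Fin n → A) →
                   allB p (tabulate h) ≡ true → ∀ i → p (h i) ≡ true
  allB-tabulate⁻ (suc n) p h eq zero    = proj₁ (∧-true eq)
  allB-tabulate⁻ (suc n) p h eq (suc i) = allB-tabulate⁻ n p (h ∘ suc) (proj₂ (∧-true {p (h zero)} eq)) i

  allB-tabulate⁺ : ∀ {A : Set} n (p : A → Bool) (h : Fin n → A) →
                   (∀ i → p (h i) ≡ true) → allB p (tabulate h) ≡ true
  allB-tabulate⁺ zero    p h all = refl
  allB-tabulate⁺ (suc n) p h all = cong₂ _∧_ (all zero) (allB-tabulate⁺ n p (h ∘ suc) (all ∘ suc))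

  module _ {n} (P : Poset n) (σ : Fin n → Fin n) where

    private
      ok : Fin n → Fin n → Bool
      ok i j = (⌊ i ≟ j ⌋ ∨ not ⌊ σ i ≟ σ j ⌋) ∧ (not (lt P i j) ∨ ⌊ toℕ (σ i) <? toℕ (σ j) ⌋)

    isLinExt⇒LinExt : isLinExt P σ ≡ true → LinExt P σ
    isLinExt⇒LinExt eq = linExt inj mono
      where
      ok-true : ∀ i j → ok i j ≡ true
      ok-true i = allB-tabulate⁻ n (ok i) (λ j → j)
                    (allB-tabulate⁻ n (λ i → allB (ok i) (allFin n)) (λ i → i) eq i)

      inj : ∀ i j → σ i ≡ σ j → i ≡ j
      inj i j σi≡σj with i ≟ j | σ i ≟ σ j | ok-true i j
      ... | yes i≡j | _        | _ = i≡j
      ... | no _    | no σi≢σj | _ = contradiction σi≡σj σi≢σj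
      ... | no _    | yes _    | ()

      mono : ∀ i j → lt P i j ≡ true → toℕ (σ i) < toℕ (σ j)
      mono i j i<j with ok-true i j
      ... | eq′ with proj₂ (∧-true {⌊ i ≟ j ⌋ ∨ not ⌊ σ i ≟ σ j ⌋} eq′)
      ... | eq″ rewrite i<j = ⌊⌋-true⁻ (toℕ (σ i) <? toℕ (σ j)) eq″

    LinExt⇒isLinExt : LinExt P σ → isLinExt P σ ≡ true
    LinExt⇒isLinExt (linExt inj mono) =
      allB-tabulate⁺ n (λ i → allB (ok i) (allFin n)) (λ i → i)
        (λ i → allB-tabulate⁺ n (ok i) (λ j → j) (λ j → cong₂ _∧_ (inj-true i j) (mono-true i j)))
      where
      inj-true : ∀ i j → ⌊ i ≟ j ⌋ ∨ not ⌊ σ i ≟ σ j ⌋ ≡ true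
      inj-true i j with i ≟ j | σ i ≟ σ j
      ... | yes _  | _         = refl
      ... | no _   | no _      = refl
      ... | no i≢j | yes σi≡σj = contradiction (inj i j σi≡σj) i≢j

      mono-true : ∀ i j → not (lt P i j) ∨ ⌊ toℕ (σ i) <? toℕ (σ j) ⌋ ≡ true
      mono-true i j with lt P i j in eq
      ... | false = refl
      ... | true  = ⌊⌋-true (toℕ (σ i) <? toℕ (σ j)) (mono i j eq)

  LinExt-cong : ∀ {n k} (P : Poset n) {σ τ : Fin n → Fin k} → σ ≗ τ → LinExt P σ → LinExt P τ
  LinExt-cong P σ≗τ (linExt inj mono) = linExt
    (λ i j τi≡τj → inj i j (≡.trans (σ≗τ i) (≡.trans τi≡τj (sym (σ≗τ j)))))
    (λ i j i<j → ≡.subst₂ (λ a b → toℕ a < toℕ b) (σ≗τ i) (σ≗τ j) (mono i j i<j))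

  isLinExt-ext : ∀ {n} (P : Poset n) → Extensional (λ σ → ⟦ isLinExt P σ ⟧)
  isLinExt-ext P {σ} {τ} σ≗τ = cong ⟦_⟧ (≡true-ext
    (LinExt⇒isLinExt P τ ∘ LinExt-cong P σ≗τ ∘ isLinExt⇒LinExt P σ)
    (LinExt⇒isLinExt P σ ∘ LinExt-cong P (λ i → sym (σ≗τ i)) ∘ isLinExt⇒LinExt P τ))

  _−_ : ∀ {n} → Poset (suc n) → Fin (suc n) → Poset n
  P − i = record
    { lt     = λ a b → lt P (punchIn i a) (punchIn i b)
    ; irrefl = λ a → irrefl P (punchIn i a)
    ; trans  = λ a b c → trans P (punchIn i a) (punchIn i b) (punchIn i c)
    }

  Minimal : ∀ {n} → Poset n → Fin n → Set
  Minimal P i = ∀ j → lt P j i ≡ false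

  minimal? : ∀ {n} (P : Poset n) i → Dec (Minimal P i)
  minimal? P i = all? (λ j → lt P j i Bool.≟ false)

  minᵇ : ∀ {n} → Poset n → Fin n → Bool
  minᵇ P i = ⌊ minimal? P i ⌋

  -- Otherwise `punchOut` at zero would compress σ to an injection of `Fin (suc n)` into `Fin n`.
  injective⇒hits-zero : ∀ {n} (σ : Fin (suc n) → Fin (suc n)) → (∀ i j → σ i ≡ σ j → i ≡ j) → ∃ λ i → σ i ≡ zero
  injective⇒hits-zero {n} σ inj with any? (λ i → σ i ≟ zero)
  ... | yes hit = hit
  ... | no  σ≢0 = contradiction (λ {i} {j} eq → inj i j (punchOut-injective (0≢σ i) (0≢σ j) eq))
                                (<⇒notInjective {f = λ i → punchOut (0≢σ i)} (n<1+n n))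
    where
    0≢σ : ∀ i → zero ≢ σ i
    0≢σ i 0≡σi = σ≢0 (i , sym 0≡σi)

  data PunchView {n} (i : Fin (suc n)) : Fin (suc n) → Set where
    same  : PunchView i i
    other : ∀ j → PunchView i (punchIn i j)

  punchView : ∀ {n} (i j : Fin (suc n)) → PunchView i j
  punchView i j with i ≟ j
  ... | yes refl = same
  ... | no  i≢j  = subst (PunchView i) (punchIn-punchOut i≢j) (other (punchOut i≢j))

  module _ {n} (P : Poset (suc n)) (i : Fin (suc n)) (f : Fin n → Fin n) where

    private
      σ : Fin (suc n) → Fin (suc n)
      σ = insertAt (suc ∘ f) i zero

      σi : σ i ≡ zero
      σi = insertAt-lookup (suc ∘ f) i zero

      σj : ∀ j → σ (punchIn i j) ≡ suc (f j)
      σj = insertAt-punchIn (suc ∘ f) i zero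

    LinExt-insertAt⁻ : LinExt P σ → Minimal P i × LinExt (P − i) f
    LinExt-insertAt⁻ (linExt inj mono) = min , linExt
        (λ a b fa≡fb → punchIn-injective i a b (inj _ _ (≡.trans (σj a) (≡.trans (cong suc fa≡fb) (sym (σj b))))))
        (λ a b a<b → s<s⁻¹ (≡.subst₂ (λ x y → toℕ x < toℕ y) (σj a) (σj b) (mono _ _ a<b)))
      where
      min : Minimal P i
      min j with lt P j i in eq
      ... | false = refl
      ... | true  with subst (λ x → toℕ (σ j) < toℕ x) σi (mono j i eq)
      ...   | ()

    LinExt-insertAt⁺ : Minimal P i → LinExt (P − i) f → LinExt P σ
    LinExt-insertAt⁺ min (linExt inj mono) = linExt inj′ mono′
      where
      inj′ : ∀ a b → σ a ≡ σ b → a ≡ b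
      inj′ a b eq with punchView i a | punchView i b
      ... | same     | same     = refl
      ... | same     | other b′ with ≡.trans (sym σi) (≡.trans eq (σj b′))
      ...   | ()
      inj′ a b eq | other a′ | same     with ≡.trans (sym (σj a′)) (≡.trans eq σi)
      ...   | ()
      inj′ a b eq | other a′ | other b′ =
        cong (punchIn i) (inj a′ b′ (Fin.suc-injective (≡.trans (sym (σj a′)) (≡.trans eq (σj b′)))))

      mono′ : ∀ a b → lt P a b ≡ true → toℕ (σ a) < toℕ (σ b)
      mono′ a b a<b with punchView i a | punchView i b
      mono′ a b a<b | _        | same     with ≡.trans (sym a<b) (min a)
      ...   | ()
      mono′ a b a<b | same     | other b′ = ≡.subst₂ (λ x y → toℕ x < toℕ y) (sym σi) (sym (σj b′)) z<s
      mono′ a b a<b | other a′ | other b′ =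
        ≡.subst₂ (λ x y → toℕ x < toℕ y) (sym (σj a′)) (sym (σj b′)) (s<s (mono a′ b′ a<b))

    isLinExt-insertAt : ⟦ isLinExt P σ ⟧ ≡ ⟦ minᵇ P i ⟧ * ⟦ isLinExt (P − i) f ⟧
    isLinExt-insertAt = ≡.trans (cong ⟦_⟧ (≡true-ext to from)) (⟦∧⟧ (minᵇ P i) _)
      where
      to : isLinExt P σ ≡ true → minᵇ P i ∧ isLinExt (P − i) f ≡ true
      to eq with LinExt-insertAt⁻ (isLinExt⇒LinExt P σ eq)
      ... | min , le = cong₂ _∧_ (⌊⌋-true (minimal? P i) min) (LinExt⇒isLinExt (P − i) f le)

      from : minᵇ P i ∧ isLinExt (P − i) f ≡ true → isLinExt P σ ≡ true
      from eq with ∧-true {minᵇ P i} eq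
      ... | eq₁ , eq₂ = LinExt⇒isLinExt P σ
                          (LinExt-insertAt⁺ (⌊⌋-true⁻ (minimal? P i) eq₁) (isLinExt⇒LinExt (P − i) f eq₂))

  -- The point placed first by a linear extension is minimal, and the rest is a linear extension of P − i.
  e-suc : ∀ {n} (P : Poset (suc n)) → e P ≡ sumFin (suc n) (λ i → ⟦ minᵇ P i ⟧ * e (P − i))
  e-suc {n} P = begin
    e P
      ≡⟨ e≡sumFun P ⟩
    sumFun (suc n) (suc n) (λ σ → ⟦ isLinExt P σ ⟧)
      ≡⟨ sumFun-cong (suc n) (suc n) split-by-first ⟩
    sumFun (suc n) (suc n) (λ σ → sumFin (suc n) (λ i → ⟦ ⌊ σ i ≟ zero ⌋ ⟧ * ⟦ isLinExt P σ ⟧))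
      ≡⟨ sumFun-sum (suc n) (suc n) (suc n) (λ i σ → ⟦ ⌊ σ i ≟ zero ⌋ ⟧ * ⟦ isLinExt P σ ⟧) ⟩
    sumFin (suc n) (λ i → sumFun (suc n) (suc n) (λ σ → ⟦ ⌊ σ i ≟ zero ⌋ ⟧ * ⟦ isLinExt P σ ⟧))
      ≡⟨ sum-cong (suc n) first ⟩
    sumFin (suc n) (λ i → ⟦ minᵇ P i ⟧ * e (P − i)) ∎
    where
    open ≡-Reasoning

    split-by-first : ∀ σ → ⟦ isLinExt P σ ⟧ ≡ sumFin (suc n) (λ i → ⟦ ⌊ σ i ≟ zero ⌋ ⟧ * ⟦ isLinExt P σ ⟧)
    split-by-first σ with isLinExt P σ in eq
    ... | false = sym (≡.trans (sum-cong (suc n) (λ i → *-zeroʳ ⟦ ⌊ σ i ≟ zero ⌋ ⟧)) (sum-zero (suc n)))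
    ... | true  with isLinExt⇒LinExt P σ eq
    ...   | linExt inj mono with injective⇒hits-zero σ inj
    ...     | i , σi≡0 = sym (≡.trans
                  (sum-single (suc n) i (λ i → ⟦ ⌊ σ i ≟ zero ⌋ ⟧ * 1)
                    (λ j j≢i → cong (λ b → ⟦ b ⟧ * 1)
                      (⌊⌋-false (σ j ≟ zero) (λ σj≡0 → j≢i (inj j i (≡.trans σj≡0 (sym σi≡0)))))))
                  (cong (λ b → ⟦ b ⟧ * 1) (⌊⌋-true (σ i ≟ zero) σi≡0)))

    first : ∀ i → sumFun (suc n) (suc n) (λ σ → ⟦ ⌊ σ i ≟ zero ⌋ ⟧ * ⟦ isLinExt P σ ⟧) ≡ ⟦ minᵇ P i ⟧ * e (P − i)
    first i = begin
      sumFun (suc n) (suc n) (λ σ → ⟦ ⌊ σ i ≟ zero ⌋ ⟧ * ⟦ isLinExt P σ ⟧)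
        ≡⟨ sumFun-insertAt n (suc n) i _ (λ {σ} {τ} σ≗τ →
             cong₂ _*_ (cong (λ x → ⟦ ⌊ x ≟ zero ⌋ ⟧) (σ≗τ i)) (isLinExt-ext P σ≗τ)) ⟩
      sumFun n (suc n) (λ f → sumFin (suc n) (λ a → ⟦ ⌊ insertAt f i a i ≟ zero ⌋ ⟧ * ⟦ isLinExt P (insertAt f i a) ⟧))
        ≡⟨ sumFun-cong n (suc n) first-is-zero ⟩
      sumFun n (suc n) (λ f → ⟦ isLinExt P (insertAt f i zero) ⟧)
        -- Position zero is taken by `i`, so injectivity keeps every other point away from it.
        ≡⟨ sumFun-suc n n _ (λ f≗f′ → isLinExt-ext P (insertAt-cong i f≗f′)) avoids-zero ⟩
      sumFun n n (λ f → ⟦ isLinExt P (insertAt (suc ∘ f) i zero) ⟧)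
        ≡⟨ sumFun-cong n n (isLinExt-insertAt P i) ⟩
      sumFun n n (λ f → ⟦ minᵇ P i ⟧ * ⟦ isLinExt (P − i) f ⟧)
        ≡⟨ sumFun-*ˡ n n ⟦ minᵇ P i ⟧ _ ⟩
      ⟦ minᵇ P i ⟧ * sumFun n n (λ f → ⟦ isLinExt (P − i) f ⟧)
        ≡⟨ cong (⟦ minᵇ P i ⟧ *_) (sym (e≡sumFun (P − i))) ⟩
      ⟦ minᵇ P i ⟧ * e (P − i) ∎
      where
      insertAt-cong : ∀ {n} (i : Fin (suc n)) {k} {a : Fin k} {f f′ : Fin n → Fin k} →
                      f ≗ f′ → insertAt f i a ≗ insertAt f′ i a
      insertAt-cong i {f = f} {f′} f≗f′ j with punchView i j
      ... | same     = ≡.trans (insertAt-lookup f i _) (sym (insertAt-lookup f′ i _))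
      ... | other j′ = ≡.trans (insertAt-punchIn f i _ j′) (≡.trans (f≗f′ j′) (sym (insertAt-punchIn f′ i _ j′)))

      first-is-zero : ∀ f → sumFin (suc n) (λ a → ⟦ ⌊ insertAt f i a i ≟ zero ⌋ ⟧ * ⟦ isLinExt P (insertAt f i a) ⟧)
                          ≡ ⟦ isLinExt P (insertAt f i zero) ⟧
      first-is-zero f = ≡.trans
        (sum-single (suc n) zero _ (λ a a≢0 → cong (λ b → ⟦ b ⟧ * ⟦ isLinExt P (insertAt f i a) ⟧)
          (⌊⌋-false (insertAt f i a i ≟ zero) (λ eq → a≢0 (≡.trans (sym (insertAt-lookup f i a)) eq)))))
        (≡.trans (cong (λ b → ⟦ b ⟧ * ⟦ isLinExt P (insertAt f i zero) ⟧)
          (⌊⌋-true (insertAt f i zero i ≟ zero) (insertAt-lookup f i zero))) (+-identityʳ _))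

      avoids-zero : ∀ f j → f j ≡ zero → ⟦ isLinExt P (insertAt f i zero) ⟧ ≡ 0
      avoids-zero f j fj≡0 with isLinExt P (insertAt f i zero) in eq
      ... | false = refl
      ... | true  with isLinExt⇒LinExt P _ eq
      ...   | linExt inj _ = contradiction
                (inj (punchIn i j) i (≡.trans (insertAt-punchIn f i zero j) (≡.trans fj≡0 (sym (insertAt-lookup f i zero)))))
                (punchInᵢ≢i i j)

  ⟦⟧*-mono : ∀ b {x y} → (b ≡ true → x ≤ y) → ⟦ b ⟧ * x ≤ ⟦ b ⟧ * y
  ⟦⟧*-mono false x≤y = z≤n
  ⟦⟧*-mono true  x≤y = *-monoʳ-≤ 1 (x≤y refl)

  min⇒Minimal : ∀ {n} (P : Poset n) {i} → minᵇ P i ≡ true → Minimal P i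
  min⇒Minimal P {i} = ⌊⌋-true⁻ (minimal? P i)

  Minimal⇒min : ∀ {n} (P : Poset n) {i} → Minimal P i → minᵇ P i ≡ true
  Minimal⇒min P {i} = ⌊⌋-true (minimal? P i)

  minimal-below : ∀ {n} (P : Poset n) j → ∃ λ i → Minimal P i × (i ≡ j ⊎ lt P i j ≡ true)
  minimal-below {n} P j = go j (spo-wellFounded isSPO j)
    where
    _⊏_ : Fin n → Fin n → Set
    i ⊏ j = lt P i j ≡ true

    isSPO : IsStrictPartialOrder _≡_ _⊏_
    isSPO = record
      { isEquivalence = ≡.isEquivalence
      ; irrefl        = λ { {i} refl i⊏i → contradiction (≡.trans (sym i⊏i) (irrefl P i)) λ () }
      ; trans         = λ {i} {j} {k} → trans P i j k
      ; <-resp-≈      = (λ { refl i⊏j → i⊏j }) , (λ { refl i⊏j → i⊏j })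
      }

    go : ∀ j → Acc _⊏_ j → ∃ λ i → Minimal P i × (i ≡ j ⊎ lt P i j ≡ true)
    go j (acc rec) with minimal? P j
    ... | yes min = j , min , inj₁ refl
    ... | no ¬min with ¬∀⟶∃¬ n (λ i → lt P i j ≡ false) (λ i → lt P i j Bool.≟ false) ¬min
    ...   | k , ¬k≮j with go k (rec (¬-not ¬k≮j))
    ...     | i , min , inj₁ refl = i , min , inj₂ (¬-not ¬k≮j)
    ...     | i , min , inj₂ i⊏k  = i , min , inj₂ (trans P i k j i⊏k (¬-not ¬k≮j))

  -- The hook inequality

  up : ∀ {n} → Poset n → Fin n → ℕ
  up {n} P i = suc (sumFin n (λ j → ⟦ lt P i j ⟧))

  minimal-up-sets-cover : ∀ {n} (P : Poset n) → n ≤ sumFin n (λ i → ⟦ minᵇ P i ⟧ * up P i)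
  minimal-up-sets-cover {n} P = begin
    n                                                                ≡⟨ sym (*-identityʳ n) ⟩
    n * 1                                                            ≡⟨ sym (sum-const n 1) ⟩
    sumFin n (λ j → 1)                                               ≤⟨ sum-mono n covered ⟩
    sumFin n (λ j → sumFin n (λ i → ⟦ minᵇ P i ⟧ * le i j))          ≡⟨ sum-swap n n _ ⟩
    sumFin n (λ i → sumFin n (λ j → ⟦ minᵇ P i ⟧ * le i j))          ≡⟨ sum-cong n (λ i → sum-*ˡ n ⟦ minᵇ P i ⟧ (le i)) ⟩
    sumFin n (λ i → ⟦ minᵇ P i ⟧ * sumFin n (le i))                  ≡⟨ sum-cong n (λ i → cong (⟦ minᵇ P i ⟧ *_) (sum-le i)) ⟩
    sumFin n (λ i → ⟦ minᵇ P i ⟧ * up P i)                           ∎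
    where
    open ≤-Reasoning

    le : Fin n → Fin n → ℕ
    le i j = ⟦ ⌊ i ≟ j ⌋ ⟧ + ⟦ lt P i j ⟧

    sum-le : ∀ i → sumFin n (le i) ≡ up P i
    sum-le i = ≡.trans (sum-+ n (λ j → ⟦ ⌊ i ≟ j ⌋ ⟧) (λ j → ⟦ lt P i j ⟧))
      (cong (_+ sumFin n (λ j → ⟦ lt P i j ⟧)) (≡.trans
        (sum-single n i _ (λ j j≢i → cong ⟦_⟧ (⌊⌋-false (i ≟ j) (j≢i ∘ sym))))
        (cong ⟦_⟧ (⌊⌋-true (i ≟ i) refl))))

    covered : ∀ j → 1 ≤ sumFin n (λ i → ⟦ minᵇ P i ⟧ * le i j)
    covered j with minimal-below P j
    ... | i , min , i≤j = ≤-trans (≤-trans (1≤le i≤j) (≤-reflexive (sym min*le))) (term≤sum n i _)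
      where
      min*le : ⟦ minᵇ P i ⟧ * le i j ≡ le i j
      min*le = ≡.trans (cong (λ b → ⟦ b ⟧ * le i j) (Minimal⇒min P min)) (+-identityʳ _)

      1≤le : i ≡ j ⊎ lt P i j ≡ true → 1 ≤ le i j
      1≤le (inj₁ i≡j) = ≤-trans (≤-reflexive (sym (cong ⟦_⟧ (⌊⌋-true (i ≟ j) i≡j)))) (m≤m+n _ _)
      1≤le (inj₂ i<j) = ≤-trans (≤-reflexive (sym (cong ⟦_⟧ i<j))) (m≤n+m _ ⟦ ⌊ i ≟ j ⌋ ⟧)

  up-punchIn : ∀ {n} (P : Poset (suc n)) {i} → Minimal P i → ∀ j → up P (punchIn i j) ≡ up (P − i) j
  up-punchIn {n} P {i} min j = cong suc (≡.trans (sum-punchIn n i (λ k → ⟦ lt P (punchIn i j) k ⟧))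
    (cong (λ b → ⟦ b ⟧ + sumFin n (λ k → ⟦ lt (P − i) j k ⟧)) (min (punchIn i j))))

  prod-up : ∀ {n} (P : Poset (suc n)) {i} → Minimal P i → prodFin (suc n) (up P) ≡ up P i * prodFin n (up (P − i))
  prod-up {n} P {i} min = ≡.trans (prod-punchIn n i (up P)) (cong (up P i *_) (prod-cong n (up-punchIn P min)))

  -- Removing a minimal point leaves the other up-sets unchanged.
  factorial≤e*prod-up : ∀ n (P : Poset n) → n ! ≤ e P * prodFin n (up P)
  factorial≤e*prod-up zero    P = ≤-refl
  factorial≤e*prod-up (suc n) P = begin
    suc n * n !
      ≤⟨ *-monoˡ-≤ (n !) (minimal-up-sets-cover P) ⟩
    sumFin (suc n) (λ i → ⟦ minᵇ P i ⟧ * up P i) * n !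
      ≡⟨ sym (sum-*ʳ (suc n) (n !) (λ i → ⟦ minᵇ P i ⟧ * up P i)) ⟩
    sumFin (suc n) (λ i → ⟦ minᵇ P i ⟧ * up P i * n !)
      ≤⟨ sum-mono (suc n) step ⟩
    sumFin (suc n) (λ i → ⟦ minᵇ P i ⟧ * e (P − i) * prodFin (suc n) (up P))
      ≡⟨ sum-*ʳ (suc n) (prodFin (suc n) (up P)) (λ i → ⟦ minᵇ P i ⟧ * e (P − i)) ⟩
    sumFin (suc n) (λ i → ⟦ minᵇ P i ⟧ * e (P − i)) * prodFin (suc n) (up P)
      ≡⟨ cong (_* prodFin (suc n) (up P)) (sym (e-suc P)) ⟩
    e P * prodFin (suc n) (up P) ∎
    where
    open ≤-Reasoning

    step : ∀ i → ⟦ minᵇ P i ⟧ * up P i * n ! ≤ ⟦ minᵇ P i ⟧ * e (P − i) * prodFin (suc n) (up P)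
    step i = begin
      ⟦ minᵇ P i ⟧ * up P i * n !
        ≡⟨ *-assoc ⟦ minᵇ P i ⟧ _ _ ⟩
      ⟦ minᵇ P i ⟧ * (up P i * n !)
        ≤⟨ ⟦⟧*-mono (minᵇ P i) (λ eq → begin
             up P i * n !                                     ≤⟨ *-monoʳ-≤ (up P i) (factorial≤e*prod-up n (P − i)) ⟩
             up P i * (e (P − i) * prodFin n (up (P − i)))    ≡⟨ *-left-comm (up P i) (e (P − i)) _ ⟩
             e (P − i) * (up P i * prodFin n (up (P − i)))    ≡⟨ cong (e (P − i) *_) (sym (prod-up P (min⇒Minimal P eq))) ⟩
             e (P − i) * prodFin (suc n) (up P)               ∎) ⟩
      ⟦ minᵇ P i ⟧ * (e (P − i) * prodFin (suc n) (up P))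
        ≡⟨ sym (*-assoc ⟦ minᵇ P i ⟧ _ _) ⟩
      ⟦ minᵇ P i ⟧ * e (P − i) * prodFin (suc n) (up P) ∎

  -- The incomparability bound

  _≺_ : ∀ {n} → Fin n → Fin n → Bool
  i ≺ j = toℕ i <ᵇ toℕ j

  ≺-punchIn : ∀ {n} (i : Fin (suc n)) a b → punchIn i a ≺ punchIn i b ≡ a ≺ b
  ≺-punchIn zero    a       b       = refl
  ≺-punchIn (suc i) zero    zero    = refl
  ≺-punchIn (suc i) zero    (suc b) = refl
  ≺-punchIn (suc i) (suc a) zero    = refl
  ≺-punchIn (suc i) (suc a) (suc b) = ≺-punchIn i a b

  inc : ∀ {n} → Poset n → Fin n → Fin n → Bool
  inc P i j = not (lt P i j) ∧ not (lt P j i)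

  -- "Later" refers to the numbering of `Fin n`, which need not be related to the order of `P`; the
  -- bound by these factors holds for every numbering.
  incLater : ∀ {n} → Poset n → Fin n → ℕ
  incLater {n} P i = sumFin n (λ j → ⟦ i ≺ j ∧ inc P i j ⟧)

  incLater-punchIn : ∀ {n} (P : Poset (suc n)) i j →
    incLater P (punchIn i j) ≡ ⟦ punchIn i j ≺ i ∧ inc P (punchIn i j) i ⟧ + incLater (P − i) j
  incLater-punchIn {n} P i j = ≡.trans (sum-punchIn n i (λ k → ⟦ punchIn i j ≺ k ∧ inc P (punchIn i j) k ⟧))
    (cong (⟦ punchIn i j ≺ i ∧ inc P (punchIn i j) i ⟧ +_)
      (sum-cong n (λ k → cong (λ b → ⟦ b ∧ inc (P − i) j k ⟧) (≺-punchIn i j k))))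

  skip : ∀ {n} → (Fin (suc n) → ℕ) → (Fin (suc n) → Bool) → Fin (suc n) → Fin n → ℕ
  skip D μ x j = if punchIn x j ≺ x then D (punchIn x j) ∸ ⟦ μ (punchIn x j) ⟧ else D (punchIn x j)

  -- Expand ∏ (D⁻ + ⟦ μ ⟧), where D⁻ = D ∸ ⟦ μ ⟧, by the first factor that contributes its ⟦ μ ⟧.
  telescope : ∀ n (D : Fin (suc n) → ℕ) (μ : Fin (suc n) → Bool) → (∀ v → 1 ≤ D v) →
    sumFin (suc n) (λ x → ⟦ μ x ⟧ * prodFin n (skip D μ x)) + prodFin (suc n) (λ v → D v ∸ ⟦ μ v ⟧)
      ≡ prodFin (suc n) D
  telescope zero    D μ 1≤D = single (μ zero) (D zero) (1≤D zero)
    where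
    single : ∀ b d → 1 ≤ d → ⟦ b ⟧ * 1 + 0 + (d ∸ ⟦ b ⟧) * 1 ≡ d * 1
    single true  (suc d) _ = refl
    single false d       _ = refl
  telescope (suc n) D μ 1≤D = begin
    ⟦ μ zero ⟧ * prodFin (suc n) D′ + sumFin (suc n) (λ x → ⟦ μ (suc x) ⟧ * (d⁻ * prodFin n (skip D′ μ′ x))) + d⁻ * R
      ≡⟨ cong (λ s → ⟦ μ zero ⟧ * prodFin (suc n) D′ + s + d⁻ * R) (≡.trans
           (sum-cong (suc n) (λ x → *-left-comm ⟦ μ (suc x) ⟧ d⁻ (prodFin n (skip D′ μ′ x))))
           (sum-*ˡ (suc n) d⁻ (λ x → ⟦ μ (suc x) ⟧ * prodFin n (skip D′ μ′ x)))) ⟩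
    ⟦ μ zero ⟧ * prodFin (suc n) D′ + d⁻ * T + d⁻ * R
      ≡⟨ regroup ⟦ μ zero ⟧ (prodFin (suc n) D′) d⁻ T R ⟩
    ⟦ μ zero ⟧ * prodFin (suc n) D′ + d⁻ * (T + R)
      ≡⟨ cong (λ s → ⟦ μ zero ⟧ * prodFin (suc n) D′ + d⁻ * s) (telescope n D′ μ′ (1≤D ∘ suc)) ⟩
    ⟦ μ zero ⟧ * prodFin (suc n) D′ + d⁻ * prodFin (suc n) D′
      ≡⟨ sym (*-distribʳ-+ (prodFin (suc n) D′) ⟦ μ zero ⟧ d⁻) ⟩
    (⟦ μ zero ⟧ + d⁻) * prodFin (suc n) D′
      ≡⟨ cong (_* prodFin (suc n) D′) (restore (D zero) (μ zero) (1≤D zero)) ⟩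
    D zero * prodFin (suc n) D′ ∎
    where
    open ≡-Reasoning

    D′ = D ∘ suc
    μ′ = μ ∘ suc
    d⁻ = D zero ∸ ⟦ μ zero ⟧
    T  = sumFin (suc n) (λ x → ⟦ μ′ x ⟧ * prodFin n (skip D′ μ′ x))
    R  = prodFin (suc n) (λ v → D′ v ∸ ⟦ μ′ v ⟧)

    restore : ∀ d b → 1 ≤ d → ⟦ b ⟧ + (d ∸ ⟦ b ⟧) ≡ d
    restore d       false _ = refl
    restore (suc d) true  _ = refl

    regroup : ∀ m p d t r → m * p + d * t + d * r ≡ m * p + d * (t + r)
    regroup = solve-∀

  module _ {n} (P : Poset (suc n)) {i} (min : Minimal P i) where

    private
      D : Fin (suc n) → ℕ
      D v = suc (incLater P v)

    -- Deleting `i` lowers `incLater` by one at each earlier point incomparable to `i`. Minimal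
    -- points are incomparable to the minimal point `i`, and `skip` subtracts only at those.
    incLater≤skip : ∀ j → suc (incLater (P − i) j) ≤ skip D (minᵇ P) i j
    incLater≤skip j with punchIn i j ≺ i | incLater-punchIn P i j
    ... | false | eq = s≤s (≤-reflexive (sym eq))
    ... | true  | eq with minimal? P (punchIn i j)
    ...   | no _    = s≤s (≤-trans (m≤n+m _ ⟦ inc P (punchIn i j) i ⟧) (≤-reflexive (sym eq)))
    ...   | yes min′ rewrite min (punchIn i j) | min′ i = ≤-reflexive (sym eq)

    -- The reverse holds once the points incomparable to `i` are all minimal, since then `skip`
    -- subtracts wherever the deletion of `i` does.
    skip≤incLater : (∀ v → inc P v i ≡ true → Minimal P v) →
                    ∀ j → skip D (minᵇ P) i j ≤ suc (incLater (P − i) j)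
    skip≤incLater inc⇒min j with punchIn i j ≺ i | incLater-punchIn P i j
    ... | false | eq = s≤s (≤-reflexive eq)
    ... | true  | eq with inc P (punchIn i j) i in eq-inc
    ...   | false = ≤-trans (m∸n≤m _ ⟦ minᵇ P (punchIn i j) ⟧) (s≤s (≤-reflexive eq))
    ...   | true  rewrite Minimal⇒min P (inc⇒min (punchIn i j) eq-inc) = ≤-reflexive eq

  -- By `e-suc` and induction, `e P` is at most the sum of the `skip` products over minimal `i`. By
  -- `telescope` this sum falls short of the full product by ∏ (D v ∸ ⟦ minᵇ P v ⟧), which is
  -- nonnegative.
  e≤prod-incLater : ∀ n (P : Poset n) → e P ≤ prodFin n (λ i → suc (incLater P i))
  e≤prod-incLater zero    P = ≤-refl
  e≤prod-incLater (suc n) P = begin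
    e P
      ≡⟨ e-suc P ⟩
    sumFin (suc n) (λ i → ⟦ minᵇ P i ⟧ * e (P − i))
      ≤⟨ sum-mono (suc n) (λ i → ⟦⟧*-mono (minᵇ P i) (λ eq →
           ≤-trans (e≤prod-incLater n (P − i)) (prod-mono n {g = skip D (minᵇ P) i} (incLater≤skip P (min⇒Minimal P eq))))) ⟩
    sumFin (suc n) (λ i → ⟦ minᵇ P i ⟧ * prodFin n (skip D (minᵇ P) i))
      ≤⟨ m≤m+n _ _ ⟩
    sumFin (suc n) (λ i → ⟦ minᵇ P i ⟧ * prodFin n (skip D (minᵇ P) i)) + prodFin (suc n) (λ v → D v ∸ ⟦ minᵇ P v ⟧)
      ≡⟨ telescope n D (minᵇ P) (λ v → s≤s z≤n) ⟩
    prodFin (suc n) D ∎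
    where
    open ≤-Reasoning

    D : Fin (suc n) → ℕ
    D v = suc (incLater P v)

  -- For strict orders this is equivalent to transitivity of incomparability. In this form it passes
  -- to `P − i` directly and shows that a point incomparable to a minimal point is minimal.
  Weak : ∀ {n} → Poset n → Set
  Weak P = ∀ i j k → inc P i j ≡ true → lt P k i ≡ true → lt P k j ≡ true

  last-true : ∀ n (μ : Fin n → Bool) → ∃ (λ i → μ i ≡ true) →
              ∃ λ i → μ i ≡ true × (∀ j → i ≺ j ≡ true → μ j ≡ false)
  last-true (suc n) μ (i , μi) with any? (λ j → μ (suc j) Bool.≟ true)
  ... | yes hit with last-true n (μ ∘ suc) hit
  ...   | k , μk , later = suc k , μk , λ { (suc j) → later j }
  last-true (suc n) μ (zero  , μi) | no none = zero , μi , λ { (suc j) _ → ¬-not (λ μj → none (j , μj)) }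
  last-true (suc n) μ (suc i , μi) | no none = contradiction (i , μi) none

  -- Both losses in the upper bound disappear: the factors match by `skip≤incLater`, and the product
  -- dropped there has a zero factor.
  weak-prod-incLater≤e : ∀ n (P : Poset n) → Weak P → prodFin n (λ i → suc (incLater P i)) ≤ e P
  weak-prod-incLater≤e zero    P weak = ≤-refl
  weak-prod-incLater≤e (suc n) P weak = begin
    prodFin (suc n) D
      ≡⟨ sym (telescope n D (minᵇ P) (λ v → s≤s z≤n)) ⟩
    T + prodFin (suc n) (λ v → D v ∸ ⟦ minᵇ P v ⟧)
      ≡⟨ cong (T +_) last-factor-zero ⟩
    T + 0
      ≡⟨ +-identityʳ T ⟩
    T
      ≤⟨ sum-mono (suc n) (λ i → ⟦⟧*-mono (minᵇ P i) (λ eq → ≤-trans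
           (prod-mono n {f = skip D (minᵇ P) i} (skip≤incLater P (min⇒Minimal P eq) (inc⇒min (min⇒Minimal P eq))))
           (weak-prod-incLater≤e n (P − i) (λ a b c → weak (punchIn i a) (punchIn i b) (punchIn i c))))) ⟩
    sumFin (suc n) (λ i → ⟦ minᵇ P i ⟧ * e (P − i))
      ≡⟨ sym (e-suc P) ⟩
    e P ∎
    where
    open ≤-Reasoning

    D : Fin (suc n) → ℕ
    D v = suc (incLater P v)
    T = sumFin (suc n) (λ i → ⟦ minᵇ P i ⟧ * prodFin n (skip D (minᵇ P) i))

    inc⇒min : ∀ {i} → Minimal P i → ∀ v → inc P v i ≡ true → Minimal P v
    inc⇒min {i} min v inc-vi k with lt P k v in eq
    ... | false = refl
    ... | true  = ≡.trans (sym (weak v i k inc-vi eq)) (min k)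

    inc-sym : ∀ i j → inc P i j ≡ true → inc P j i ≡ true
    inc-sym i j = ≡.trans (Bool.∧-comm (not (lt P j i)) (not (lt P i j)))

    -- The minimal point `v` with the largest number has D v = 1: a later point incomparable to `v`
    -- would be minimal as well.
    last-factor-zero : prodFin (suc n) (λ v → D v ∸ ⟦ minᵇ P v ⟧) ≡ 0
    last-factor-zero with minimal-below P zero
    ... | i , min , _ with last-true (suc n) (minᵇ P) (i , Minimal⇒min P min)
    ...   | v , min-v , later = prod-zero (suc n) v (λ v → D v ∸ ⟦ minᵇ P v ⟧)
              (≡.trans (cong (λ b → D v ∸ ⟦ b ⟧) min-v) (≡.trans (sum-cong (suc n) not-inc) (sum-zero (suc n))))
      where
      not-inc : ∀ j → ⟦ v ≺ j ∧ inc P v j ⟧ ≡ 0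
      not-inc j with v ≺ j in v≺j | inc P v j in inc-vj
      ... | false | _     = refl
      ... | true  | false = refl
      ... | true  | true  with ≡.trans (sym (later j v≺j)) (Minimal⇒min P (inc⇒min (min⇒Minimal P min-v) j (inc-sym v j inc-vj)))
      ...   | ()

  -- Posets partitioned into weighted chains

  sum-⟦⟧≤1 : ∀ n (b : Fin n → Bool) → (∀ i j → b i ≡ true → b j ≡ true → i ≡ j) → sumFin n (⟦_⟧ ∘ b) ≤ 1
  sum-⟦⟧≤1 n b unique with any? (λ i → b i Bool.≟ true)
  ... | yes (i , bi) = ≤-trans (≤-reflexive (sum-single n i _ (λ j j≢i → cong ⟦_⟧ (¬-not (λ bj → j≢i (unique j i bj bi)))))) (⟦⟧≤1 (b i))
  ... | no none      = ≤-trans (≤-reflexive (≡.trans (sum-cong n (λ i → cong ⟦_⟧ (¬-not (λ bi → none (i , bi))))) (sum-zero n))) z≤n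

  ChainPartition : ∀ {n k} → Poset n → (Fin n → Fin k) → Set
  ChainPartition P h = ∀ i j → h i ≡ h j → i ≢ j → lt P i j ≡ true ⊎ lt P j i ≡ true

  -- Two points of one class are comparable, so each class contains at most one minimal point and
  -- its weight is counted at most once.
  minimal-weights : ∀ n k (P : Poset n) (h : Fin n → Fin k) → ChainPartition P h → (p : Fin k → ℕ) →
                    sumFin n (λ i → ⟦ minᵇ P i ⟧ * p (h i)) ≤ sumFin k p
  minimal-weights n k P h chain p = begin
    sumFin n (λ i → ⟦ minᵇ P i ⟧ * p (h i))
      ≡⟨ sum-cong n by-class ⟩
    sumFin n (λ i → sumFin k (λ c → ⟦ minᵇ P i ∧ ⌊ h i ≟ c ⌋ ⟧ * p c))
      ≡⟨ sum-swap n k _ ⟩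
    sumFin k (λ c → sumFin n (λ i → ⟦ minᵇ P i ∧ ⌊ h i ≟ c ⌋ ⟧ * p c))
      ≡⟨ sum-cong k (λ c → sum-*ʳ n (p c) _) ⟩
    sumFin k (λ c → sumFin n (λ i → ⟦ minᵇ P i ∧ ⌊ h i ≟ c ⌋ ⟧) * p c)
      ≤⟨ sum-mono k (λ c → *-monoˡ-≤ (p c) (sum-⟦⟧≤1 n _ (unique c))) ⟩
    sumFin k (λ c → 1 * p c)
      ≡⟨ sum-cong k (λ c → +-identityʳ (p c)) ⟩
    sumFin k p ∎
    where
    open ≤-Reasoning

    by-class : ∀ i → ⟦ minᵇ P i ⟧ * p (h i) ≡ sumFin k (λ c → ⟦ minᵇ P i ∧ ⌊ h i ≟ c ⌋ ⟧ * p c)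
    by-class i = sym (≡.trans
      (sum-single k (h i) _ (λ c c≢hi → cong (λ b → ⟦ b ⟧ * p c)
        (≡.trans (cong (minᵇ P i ∧_) (⌊⌋-false (h i ≟ c) (c≢hi ∘ sym))) (Bool.∧-zeroʳ (minᵇ P i)))))
      (cong (λ b → ⟦ b ⟧ * p (h i))
        (≡.trans (cong (minᵇ P i ∧_) (⌊⌋-true (h i ≟ h i) refl)) (Bool.∧-identityʳ (minᵇ P i)))))

    unique : ∀ c i j → minᵇ P i ∧ ⌊ h i ≟ c ⌋ ≡ true → minᵇ P j ∧ ⌊ h j ≟ c ⌋ ≡ true → i ≡ j
    unique c i j bi bj with i ≟ j | ∧-true {minᵇ P i} bi | ∧-true {minᵇ P j} bj
    ... | yes i≡j | _            | _            = i≡j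
    ... | no i≢j  | min-i , hi≡c | min-j , hj≡c
      with chain i j (≡.trans (⌊⌋-true⁻ (h i ≟ c) hi≡c) (sym (⌊⌋-true⁻ (h j ≟ c) hj≡c))) i≢j
    ...   | inj₁ i<j with ≡.trans (sym i<j) (min⇒Minimal P min-j i)
    ...     | ()
    unique c i j bi bj | no i≢j | min-i , hi≡c | min-j , hj≡c | inj₂ j<i
      with ≡.trans (sym j<i) (min⇒Minimal P min-i j)
    ...     | ()

  -- A probabilistic reading: draw chain `c` with probability `p c / sumFin k p` at each of n steps
  -- and place the next point of that chain. Different linear extensions come from different draw
  -- sequences, each of probability `prodFin n (p ∘ h) / sumFin k p ^ n`, and these probabilities
  -- add up to at most 1.
  e*prod-weights≤ : ∀ n k (P : Poset n) (h : Fin n → Fin k) → ChainPartition P h → (p : Fin k → ℕ) →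
                    e P * prodFin n (p ∘ h) ≤ sumFin k p ^ n
  e*prod-weights≤ zero    k P h chain p = ≤-refl
  e*prod-weights≤ (suc n) k P h chain p = begin
    e P * W
      ≡⟨ cong (_* W) (e-suc P) ⟩
    sumFin (suc n) (λ i → ⟦ minᵇ P i ⟧ * e (P − i)) * W
      ≡⟨ sym (sum-*ʳ (suc n) W (λ i → ⟦ minᵇ P i ⟧ * e (P − i))) ⟩
    sumFin (suc n) (λ i → ⟦ minᵇ P i ⟧ * e (P − i) * W)
      ≤⟨ sum-mono (suc n) step ⟩
    sumFin (suc n) (λ i → ⟦ minᵇ P i ⟧ * p (h i) * sumFin k p ^ n)
      ≡⟨ sum-*ʳ (suc n) (sumFin k p ^ n) (λ i → ⟦ minᵇ P i ⟧ * p (h i)) ⟩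
    sumFin (suc n) (λ i → ⟦ minᵇ P i ⟧ * p (h i)) * sumFin k p ^ n
      ≤⟨ *-monoˡ-≤ (sumFin k p ^ n) (minimal-weights (suc n) k P h chain p) ⟩
    sumFin k p * sumFin k p ^ n ∎
    where
    open ≤-Reasoning
    W = prodFin (suc n) (p ∘ h)

    rearrange : ∀ m a b c → m * a * (b * c) ≡ m * b * (a * c)
    rearrange = solve-∀

    step : ∀ i → ⟦ minᵇ P i ⟧ * e (P − i) * W ≤ ⟦ minᵇ P i ⟧ * p (h i) * sumFin k p ^ n
    step i = begin
      ⟦ minᵇ P i ⟧ * e (P − i) * W
        ≡⟨ cong (⟦ minᵇ P i ⟧ * e (P − i) *_) (prod-punchIn n i (p ∘ h)) ⟩
      ⟦ minᵇ P i ⟧ * e (P − i) * (p (h i) * prodFin n (p ∘ h ∘ punchIn i))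
        ≡⟨ rearrange ⟦ minᵇ P i ⟧ (e (P − i)) (p (h i)) _ ⟩
      ⟦ minᵇ P i ⟧ * p (h i) * (e (P − i) * prodFin n (p ∘ h ∘ punchIn i))
        ≤⟨ *-monoʳ-≤ (⟦ minᵇ P i ⟧ * p (h i)) (e*prod-weights≤ n k (P − i) (h ∘ punchIn i)
             (λ a b ha≡hb a≢b → chain _ _ ha≡hb (a≢b ∘ punchIn-injective i a b)) p) ⟩
      ⟦ minᵇ P i ⟧ * p (h i) * sumFin k p ^ n ∎

  ^-distribʳ-* : ∀ n a b → (a * b) ^ n ≡ a ^ n * b ^ n
  ^-distribʳ-* zero    a b = refl
  ^-distribʳ-* (suc n) a b = ≡.trans (cong (a * b *_) (^-distribʳ-* n a b)) (*-interchange a b (a ^ n) (b ^ n))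

  -- The arithmetic–geometric mean inequality

  2xy≤x²+y² : ∀ x y → 2 * (x * y) ≤ x * x + y * y
  2xy≤x²+y² x y with ≤-total x y
  ... | inj₁ x≤y with m≤n⇒∃[o]m+o≡n x≤y
  ...   | d , refl = ≤-trans (m≤m+n _ (d * d)) (≤-reflexive (expand x d))
    where
    expand : ∀ x d → 2 * (x * (x + d)) + d * d ≡ x * x + (x + d) * (x + d)
    expand = solve-∀
  2xy≤x²+y² x y | inj₂ y≤x with m≤n⇒∃[o]m+o≡n y≤x
  ...   | d , refl = ≤-trans (m≤m+n _ (d * d)) (≤-reflexive (expand y d))
    where
    expand : ∀ y d → 2 * ((y + d) * y) + d * d ≡ (y + d) * (y + d) + y * y
    expand = solve-∀

  -- Bernoulli's inequality (x / y)ⁿ⁺¹ ≥ 1 + (n + 1) (x / y − 1), cleared of denominators and subtraction.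
  bernoulli : ∀ n x y → suc n * (x * y ^ n) ≤ x ^ suc n + n * y ^ suc n
  bernoulli zero    x y = ≤-reflexive (base x)
    where
    base : ∀ x → 1 * (x * 1) ≡ x * 1 + 0
    base = solve-∀
  -- The terms added to both sides make the claim the sum of `x` times the induction hypothesis and
  -- `suc n * Y` times 2xy ≤ x² + y².
  bernoulli (suc n) x y = +-cancelʳ-≤ _ _ _ (begin
    suc (suc n) * (x * (y * Y)) + (suc n * Y * (x * x) + n * (x * (y * Y)))
      ≡⟨ lhs n x y Y ⟩
    x * (suc n * (x * Y)) + suc n * Y * (2 * (x * y))
      ≤⟨ +-mono-≤ (*-monoʳ-≤ x (bernoulli n x y)) (*-monoʳ-≤ (suc n * Y) (2xy≤x²+y² x y)) ⟩
    x * (x * X + n * (y * Y)) + suc n * Y * (x * x + y * y)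
      ≡⟨ rhs n x y X Y ⟩
    x * (x * X) + suc n * (y * (y * Y)) + (suc n * Y * (x * x) + n * (x * (y * Y))) ∎)
    where
    open ≤-Reasoning
    X = x ^ n
    Y = y ^ n

    lhs : ∀ n x y Y → suc (suc n) * (x * (y * Y)) + (suc n * Y * (x * x) + n * (x * (y * Y)))
                    ≡ x * (suc n * (x * Y)) + suc n * Y * (2 * (x * y))
    lhs = solve-∀

    rhs : ∀ n x y X Y → x * (x * X + n * (y * Y)) + suc n * Y * (x * x + y * y)
                      ≡ x * (x * X) + suc n * (y * (y * Y)) + (suc n * Y * (x * x) + n * (x * (y * Y)))
    rhs = solve-∀

  -- Bernoulli's inequality for the ratio of the new mean (a + S) / (n + 1) to the old mean S / n,
  -- which is x / y with x = n (a + S) and y = (n + 1) S.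
  amgm-step : ∀ n S a → suc n ^ suc n * (a * S ^ n) ≤ n ^ n * (a + S) ^ suc n
  amgm-step zero S a = ≤-trans (≤-reflexive (base a)) (≤-trans (m≤m+n a S) (≤-reflexive (base′ a S)))
    where
    base : ∀ a → 1 * (a * 1) ≡ a
    base = solve-∀
    base′ : ∀ a S → a + S ≡ 1 * ((a + S) * 1)
    base′ = solve-∀
  amgm-step n@(suc _) S a = *-cancelˡ-≤ n (+-cancelʳ-≤ (n * (y * y ^ n)) _ _ (begin
    n * (suc n * suc n ^ n * (a * S ^ n)) + n * (y * y ^ n)
      ≡⟨ cong (_+ n * (y * y ^ n)) (≡.trans (to-yⁿ n (suc n ^ n) a (S ^ n))
           (cong (λ Y → n * (suc n * (a * Y))) (sym (^-distribʳ-* n (suc n) S)))) ⟩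
    n * (suc n * (a * y ^ n)) + n * (y * y ^ n)
      ≡⟨ factor n S a (y ^ n) ⟩
    suc n * (x * y ^ n)
      ≤⟨ bernoulli n x y ⟩
    x ^ suc n + n * (y * y ^ n)
      ≡⟨ cong (_+ n * (y * y ^ n)) (≡.trans (^-distribʳ-* (suc n) n (a + S)) (*-assoc n (n ^ n) _)) ⟩
    n * (n ^ n * (a + S) ^ suc n) + n * (y * y ^ n) ∎))
    where
    open ≤-Reasoning
    x = n * (a + S)
    y = suc n * S

    to-yⁿ : ∀ n N a T → n * (suc n * N * (a * T)) ≡ n * (suc n * (a * (N * T)))
    to-yⁿ = solve-∀

    factor : ∀ n S a Y → n * (suc n * (a * Y)) + n * (suc n * S * Y) ≡ suc n * (n * (a + S) * Y)
    factor = solve-∀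

  n^n≢0 : ∀ n → NonZero (n ^ n)
  n^n≢0 zero      = _
  n^n≢0 n@(suc _) = m^n≢0 n n

  amgm : ∀ n (z : Fin n → ℕ) → n ^ n * prodFin n z ≤ sumFin n z ^ n
  amgm zero    z = ≤-refl
  amgm (suc n) z = *-cancelˡ-≤ (n ^ n) {{n^n≢0 n}} (begin
    n ^ n * (suc n ^ suc n * (z zero * Π))     ≡⟨ regroup (n ^ n) (suc n ^ suc n) (z zero) Π ⟩
    suc n ^ suc n * (z zero * (n ^ n * Π))     ≤⟨ *-monoʳ-≤ (suc n ^ suc n) (*-monoʳ-≤ (z zero) (amgm n (z ∘ suc))) ⟩
    suc n ^ suc n * (z zero * S ^ n)           ≤⟨ amgm-step n S (z zero) ⟩
    n ^ n * (z zero + S) ^ suc n               ∎)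
    where
    open ≤-Reasoning
    Π = prodFin n (z ∘ suc)
    S = sumFin n (z ∘ suc)

    regroup : ∀ a b c d → a * (b * (c * d)) ≡ b * (c * (a * d))
    regroup = solve-∀

  -- Products with bounded factors and small sum

  -- Truncated subtraction supplies the positive part (ν - t (m - i))⁺. In the application ν = m =
  -- n; they are kept apart because the inductions lower m while ν stays fixed.
  slack : ℕ → ℕ → ∀ m → Fin m → ℕ
  slack t ν m i = ν ∸ t * (m ∸ toℕ i)

  -- The sum over j = 1, ..., m of (ν - t j)⁺ is at most the integral of this decreasing function
  -- over [0, m], which is (ν² - ((ν - t m)⁺)²) / (2t). The subtracted square is what makes the
  -- induction go through.
  sum-slack : ∀ t ν m → 2 * t * sumFin m (slack t ν m) + (ν ∸ t * m) * (ν ∸ t * m) ≤ ν * ν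
  sum-slack t ν zero    rewrite *-zeroʳ (2 * t) | *-zeroʳ t = ≤-refl
  sum-slack t ν (suc m) = begin
    2 * t * (a + W) + a * a              ≡⟨ regroup (2 * t) a W ⟩
    (2 * t * a + a * a) + 2 * t * W      ≤⟨ +-monoˡ-≤ (2 * t * W) (subst (λ a → 2 * t * a + a * a ≤ b * b) (sym a≡b∸t) (square b)) ⟩
    b * b + 2 * t * W                    ≡⟨ +-comm (b * b) _ ⟩
    2 * t * W + b * b                    ≤⟨ sum-slack t ν m ⟩
    ν * ν                                ∎
    where
    open ≤-Reasoning
    a = ν ∸ t * suc m
    b = ν ∸ t * m
    W = sumFin m (slack t ν m)

    a≡b∸t : a ≡ b ∸ t
    a≡b∸t = ≡.trans (cong (ν ∸_) (≡.trans (*-suc t m) (+-comm t (t * m)))) (sym (∸-+-assoc ν (t * m) t))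

    regroup : ∀ x a w → x * (a + w) + a * a ≡ (x * a + a * a) + x * w
    regroup = solve-∀

    square : ∀ b → 2 * t * (b ∸ t) + (b ∸ t) * (b ∸ t) ≤ b * b
    square b with ≤-total t b
    ... | inj₂ b≤t rewrite m≤n⇒m∸n≡0 b≤t | *-zeroʳ (2 * t) = z≤n
    ... | inj₁ t≤b with m≤n⇒∃[o]m+o≡n t≤b
    ...   | c , refl rewrite m+n∸m≡n t c = ≤-trans (m≤m+n _ (t * t)) (≤-reflexive (expand t c))
      where
      expand : ∀ t c → 2 * t * c + c * c + t * t ≡ (t + c) * (t + c)
      expand = solve-∀

  -- For k > 0 and y = d / k in [0, 1] this says (ν - t k) y ≤ (ν - t k)⁺.
  scaled-factor : ∀ ν t k d → d ≤ k → ν * d ≤ k * (t * d + (ν ∸ t * k))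
  scaled-factor ν t k d d≤k with ≤-total (t * k) ν
  ... | inj₂ ν≤tk = ≤-trans (*-monoˡ-≤ d ν≤tk)
                     (≤-trans (≤-reflexive (swap t k d)) (*-monoʳ-≤ k (m≤m+n (t * d) _)))
    where
    swap : ∀ t k d → t * k * d ≡ k * (t * d)
    swap = solve-∀
  ... | inj₁ tk≤ν with m≤n⇒∃[o]m+o≡n tk≤ν
  ...   | c , refl rewrite m+n∸m≡n (t * k) c = begin
    (t * k + c) * d        ≡⟨ expand t k c d ⟩
    k * (t * d) + d * c    ≤⟨ +-monoʳ-≤ (k * (t * d)) (*-monoˡ-≤ c d≤k) ⟩
    k * (t * d) + k * c    ≡⟨ sym (*-distribˡ-+ k (t * d) c) ⟩
    k * (t * d + c)        ∎
    where
    open ≤-Reasoning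
    expand : ∀ t k c d → (t * k + c) * d ≡ k * (t * d) + d * c
    expand = solve-∀

  prod-scaled : ∀ ν t m (d : Fin m → ℕ) → (∀ i → d i ≤ m ∸ toℕ i) →
                ν ^ m * prodFin m d ≤ m ! * prodFin m (λ i → t * d i + slack t ν m i)
  prod-scaled ν t zero    d d≤ = ≤-refl
  prod-scaled ν t (suc m) d d≤ = begin
    ν * ν ^ m * (d zero * prodFin m (d ∘ suc))     ≡⟨ *-interchange ν (ν ^ m) (d zero) _ ⟩
    ν * d zero * (ν ^ m * prodFin m (d ∘ suc))     ≤⟨ *-mono-≤ (scaled-factor ν t (suc m) (d zero) (d≤ zero))
                                                               (prod-scaled ν t m (d ∘ suc) (d≤ ∘ suc)) ⟩
    suc m * z₀ * (m ! * Z)                         ≡⟨ *-interchange (suc m) z₀ (m !) Z ⟩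
    suc m * m ! * (z₀ * Z)                         ∎
    where
    open ≤-Reasoning
    z₀ = t * d zero + slack t ν (suc m) zero
    Z  = prodFin m (λ i → t * d (suc i) + slack t ν m i)

  2*choose2≤n² : ∀ n → 2 * choose2 n ≤ n * n
  2*choose2≤n² zero    = z≤n
  2*choose2≤n² (suc n) = begin
    2 * (n + choose2 n)       ≡⟨ *-distribˡ-+ 2 n (choose2 n) ⟩
    2 * n + 2 * choose2 n     ≤⟨ +-monoʳ-≤ (2 * n) (2*choose2≤n² n) ⟩
    2 * n + n * n             ≤⟨ n≤1+n _ ⟩
    suc (2 * n + n * n)       ≡⟨ expand n ⟩
    suc n * suc n             ∎
    where
    open ≤-Reasoning
    expand : ∀ n → suc (2 * n + n * n) ≡ suc n * suc n
    expand = solve-∀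

  -- gNum / gDen = c + (1 − c) / (t + 1) with c = (t p/r + 1/t) / 2; the excess over c absorbs the t/n in prod-small.
  gNum gDen : ℕ → ℕ → ℕ → ℕ
  gNum p r t = t * (t * t * p + r) + 2 * t * r
  gDen p r t = 2 * t * r * suc t

  -- The least n with t / n < 1 / (2 t r (t + 1)). As c < 1 is a fraction with denominator 2 t r,
  -- the right side is at most the allowed excess (1 - c) / (t + 1). Dividing by t + 1 rather than a
  -- constant keeps g small when t is large.
  gThreshold : ℕ → ℕ → ℕ
  gThreshold r t = suc (suc t * (2 * (t * t) * r))

  -- With dᵢ = (n − i) yᵢ and 0 ≤ yᵢ ≤ 1, the linear bound n yᵢ ≤ t dᵢ + max(0, n − t (n − i)) and the
  -- AM–GM inequality give (∏ dᵢ / n!)^(1/n) ≤ (t p/r + 1/t) / 2 + t/n.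
  prod-small : ∀ p r t n (d : Fin n → ℕ) → t * t * p + r < 2 * t * r → gThreshold r t ≤ n →
    (∀ i → d i ≤ n ∸ toℕ i) → r * sumFin n d ≤ r * n + p * choose2 n →
    gDen p r t ^ n * prodFin n d < gNum p r t ^ n * n !
  prod-small p r t n@(suc _) d a₀<b₀ N≤n d≤ Σd≤ = *-cancelˡ-< (n ^ n * n ^ n) _ _ (begin-strict
    n ^ n * n ^ n * (b ^ n * prodFin n d)
      ≡⟨ pull-b (n ^ n) (b ^ n) (prodFin n d) ⟩
    b ^ n * (n ^ n * (n ^ n * prodFin n d))
      ≤⟨ *-monoʳ-≤ (b ^ n) (*-monoʳ-≤ (n ^ n) (prod-scaled n t n d d≤)) ⟩
    b ^ n * (n ^ n * (n ! * prodFin n z))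
      ≡⟨ cong (b ^ n *_) (*-left-comm (n ^ n) (n !) (prodFin n z)) ⟩
    b ^ n * (n ! * (n ^ n * prodFin n z))
      ≤⟨ *-monoʳ-≤ (b ^ n) (*-monoʳ-≤ (n !) (amgm n z)) ⟩
    b ^ n * (n ! * Z ^ n)
      ≡⟨ *-left-comm (b ^ n) (n !) (Z ^ n) ⟩
    n ! * (b ^ n * Z ^ n)
      ≡⟨ cong (n ! *_) (sym (^-distribʳ-* n b Z)) ⟩
    n ! * (b * Z) ^ n
      <⟨ *-monoʳ-< (n !) {{n !≢0}} (^-monoˡ-< n bZ<ann) ⟩
    n ! * (a * (n * n)) ^ n
      ≡⟨ cong (n ! *_) (≡.trans (^-distribʳ-* n a (n * n)) (cong (a ^ n *_) (^-distribʳ-* n n n))) ⟩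
    n ! * (a ^ n * (n ^ n * n ^ n))
      ≡⟨ push-n (n !) (a ^ n) (n ^ n * n ^ n) ⟩
    n ^ n * n ^ n * (a ^ n * n !) ∎)
    where
    open ≤-Reasoning
    a  = gNum p r t
    b  = gDen p r t
    a₀ = t * t * p + r
    b₀ = 2 * t * r
    z  = λ i → t * d i + slack t n n i
    Z  = sumFin n z
    W  = sumFin n (slack t n n)

    pull-b : ∀ N B D → N * N * (B * D) ≡ B * (N * (N * D))
    pull-b = solve-∀
    push-n : ∀ f a N → f * (a * N) ≡ N * (a * f)
    push-n = solve-∀

    Z≡ : Z ≡ t * sumFin n d + W
    Z≡ = ≡.trans (sum-+ n (λ i → t * d i) (slack t n n)) (cong (_+ W) (sum-*ˡ n t d))

    b₀Z≤ : b₀ * Z ≤ 2 * (t * t) * r * n + a₀ * (n * n)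
    b₀Z≤ = begin
      2 * t * r * Z
        ≡⟨ cong (2 * t * r *_) Z≡ ⟩
      2 * t * r * (t * sumFin n d + W)
        ≡⟨ split t r (sumFin n d) W ⟩
      2 * (t * t) * (r * sumFin n d) + r * (2 * t * W)
        ≤⟨ +-mono-≤ (*-monoʳ-≤ (2 * (t * t)) Σd≤) (*-monoʳ-≤ r (≤-trans (m≤m+n _ _) (sum-slack t n n))) ⟩
      2 * (t * t) * (r * n + p * choose2 n) + r * (n * n)
        ≡⟨ collect t r n p (choose2 n) ⟩
      2 * (t * t) * r * n + (t * t * p * (2 * choose2 n) + r * (n * n))
        ≤⟨ +-monoʳ-≤ (2 * (t * t) * r * n) (+-monoˡ-≤ (r * (n * n)) (*-monoʳ-≤ (t * t * p) (2*choose2≤n² n))) ⟩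
      2 * (t * t) * r * n + (t * t * p * (n * n) + r * (n * n))
        ≡⟨ cong (2 * (t * t) * r * n +_) (sym (*-distribʳ-+ (n * n) (t * t * p) r)) ⟩
      2 * (t * t) * r * n + a₀ * (n * n) ∎
      where
      split : ∀ t r s w → 2 * t * r * (t * s + w) ≡ 2 * (t * t) * (r * s) + r * (2 * t * w)
      split = solve-∀
      collect : ∀ t r n p c → 2 * (t * t) * (r * n + p * c) + r * (n * n)
                            ≡ 2 * (t * t) * r * n + (t * t * p * (2 * c) + r * (n * n))
      collect = solve-∀

    bZ<ann : b * Z < a * (n * n)
    bZ<ann = begin-strict
      b₀ * suc t * Z
        ≡⟨ comm₃ b₀ (suc t) Z ⟩
      suc t * (b₀ * Z)
        ≤⟨ *-monoʳ-≤ (suc t) b₀Z≤ ⟩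
      suc t * (2 * (t * t) * r * n + a₀ * (n * n))
        ≡⟨ split (suc t) (2 * (t * t) * r) n (a₀ * (n * n)) ⟩
      suc t * (2 * (t * t) * r) * n + suc t * (a₀ * (n * n))
        <⟨ +-monoˡ-< (suc t * (a₀ * (n * n))) (*-monoˡ-< n N≤n) ⟩
      n * n + suc t * (a₀ * (n * n))
        ≡⟨ collect t a₀ (n * n) ⟩
      (t * a₀ + suc a₀) * (n * n)
        ≤⟨ *-monoˡ-≤ (n * n) (+-monoʳ-≤ (t * a₀) a₀<b₀) ⟩
      (t * a₀ + b₀) * (n * n) ∎
      where
      comm₃ : ∀ x y z → x * y * z ≡ y * (x * z)
      comm₃ = solve-∀
      split : ∀ s u n v → s * (u * n + v) ≡ s * u * n + s * v
      split = solve-∀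
      collect : ∀ t a m → m + suc t * (a * m) ≡ (t * a + suc a) * m
      collect = solve-∀

  -- Choosing the integer parameter t

  searchRoot : ℕ → ℕ → ℕ → ℕ
  searchRoot p r zero = zero
  searchRoot p r (suc k) with suc k * suc k * p ≤? r
  ... | yes _ = suc k
  ... | no  _ = searchRoot p r k

  -- The largest t ≤ r with t² p ≤ r, an integer version of √(r / p).
  root : ℕ → ℕ → ℕ
  root p r = searchRoot p r r

  root-sound : ∀ p r → root p r * root p r * p ≤ r
  root-sound p r = go r
    where
    go : ∀ k → searchRoot p r k * searchRoot p r k * p ≤ r
    go zero = z≤n
    go (suc k) with suc k * suc k * p ≤? r
    ... | yes ok = ok
    ... | no  _  = go k

  root-greatest : ∀ p r t → 1 ≤ p → t * t * p ≤ r → t ≤ root p r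
  root-greatest p r t 1≤p t²p≤r = go r t≤r
    where
    t≤r : t ≤ r
    t≤r = ≤-trans (≤-trans (t≤t² t) (≤-trans (≤-reflexive (sym (*-identityʳ (t * t)))) (*-monoʳ-≤ (t * t) 1≤p))) t²p≤r
      where
      t≤t² : ∀ t → t ≤ t * t
      t≤t² zero    = z≤n
      t≤t² (suc t) = m≤m+n (suc t) _

    go : ∀ k → t ≤ k → t ≤ searchRoot p r k
    go zero    t≤k = t≤k
    go (suc k) t≤k with suc k * suc k * p ≤? r
    ... | yes _  = t≤k
    ... | no ¬ok with m≤n⇒m<n∨m≡n t≤k
    ...   | inj₁ (s≤s t≤k′) = go k t≤k′
    ...   | inj₂ refl       = contradiction t²p≤r ¬ok

  1≤root : ∀ p r → 1 ≤ p → p ≤ r → 1 ≤ root p r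
  1≤root p r 1≤p p≤r = root-greatest p r 1 1≤p (≤-trans (≤-reflexive (+-identityʳ p)) p≤r)

  -- That is, (t p/r + 1/t) / 2 < 1.
  g-gap : ∀ p r t → 1 ≤ t → t * t * p ≤ r → p < r → t * t * p + r < 2 * t * r
  g-gap p r 1             _ _      p<r = ≤-trans (+-monoˡ-< r (≤-trans (s≤s (≤-reflexive (+-identityʳ p))) p<r))
                                                (≤-reflexive (double r))
    where
    double : ∀ r → r + r ≡ 2 * 1 * r
    double = solve-∀
  g-gap p r (suc (suc t)) _ t²p≤r p<r = begin-strict
    suc (suc t) * suc (suc t) * p + r        ≤⟨ +-monoˡ-≤ r t²p≤r ⟩
    r + r                                    <⟨ m<m+n (r + r) {r} (≤-trans (s≤s z≤n) p<r) ⟩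
    r + r + r                                ≤⟨ m≤m+n _ (r + 2 * t * r) ⟩
    r + r + r + (r + 2 * t * r)              ≡⟨ expand t r ⟩
    2 * suc (suc t) * r                      ∎
    where
    open ≤-Reasoning
    expand : ∀ t r → r + r + r + (r + 2 * t * r) ≡ 2 * suc (suc t) * r
    expand = solve-∀

  -- Comparable and incomparable pairs

  sum-suc : ∀ n (f : Fin n → ℕ) → sumFin n (suc ∘ f) ≡ n + sumFin n f
  sum-suc n f = ≡.trans (sum-+ n (λ _ → 1) f)
                        (cong (_+ sumFin n f) (≡.trans (sum-const n 1) (*-identityʳ n)))

  sum-≺ : ∀ n (i : Fin n) → sumFin n (λ j → ⟦ i ≺ j ⟧) + suc (toℕ i) ≡ n
  sum-≺ (suc n) zero    = ≡.trans (cong (_+ 1) (≡.trans (sum-const n 1) (*-identityʳ n))) (+-comm n 1)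
  sum-≺ (suc n) (suc i) = ≡.trans (+-suc _ (suc (toℕ i))) (cong suc (sum-≺ n i))

  sum-sum-≺ : ∀ n → sumFin n (λ i → sumFin n (λ j → ⟦ i ≺ j ⟧)) ≡ choose2 n
  sum-sum-≺ zero    = refl
  sum-sum-≺ (suc n) = cong₂ _+_ (≡.trans (sum-const n 1) (*-identityʳ n)) (sum-sum-≺ n)

  sum-toℕ : ∀ n → sumFin n toℕ ≡ choose2 n
  sum-toℕ zero    = refl
  sum-toℕ (suc n) = ≡.trans (sum-suc n toℕ) (cong (n +_) (sum-toℕ n))

  sum-symmetrize : ∀ n (f : Fin n → Fin n → ℕ) → (∀ i → f i i ≡ 0) →
    sumFin n (λ i → sumFin n (f i)) ≡ sumFin n (λ i → sumFin n (λ j → ⟦ i ≺ j ⟧ * (f i j + f j i)))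
  sum-symmetrize zero    f fii≡0 = refl
  sum-symmetrize (suc n) f fii≡0 = begin
    f zero zero + R + sumFin n (λ i → f (suc i) zero + sumFin n (λ j → f (suc i) (suc j)))
      ≡⟨ cong₂ (λ x y → x + R + y) (fii≡0 zero) (sum-+ n (λ i → f (suc i) zero) _) ⟩
    R + (C + sumFin n (λ i → sumFin n (λ j → f (suc i) (suc j))))
      ≡⟨ cong (λ x → R + (C + x)) (sum-symmetrize n (λ i j → f (suc i) (suc j)) (fii≡0 ∘ suc)) ⟩
    R + (C + F)
      ≡⟨ sym (+-assoc R C F) ⟩
    R + C + F
      ≡⟨ cong (_+ F) (sym (≡.trans (sum-cong n (λ j → +-identityʳ _)) (sum-+ n (λ j → f zero (suc j)) _))) ⟩
    sumFin n (λ j → 1 * (f zero (suc j) + f (suc j) zero)) + F ∎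
    where
    open ≡-Reasoning
    R = sumFin n (λ j → f zero (suc j))
    C = sumFin n (λ i → f (suc i) zero)
    F = sumFin n (λ i → sumFin n (λ j → ⟦ i ≺ j ⟧ * (f (suc i) (suc j) + f (suc j) (suc i))))

  comp+inc : ∀ {n} (P : Poset n) → comp P + sumFin n (incLater P) ≡ choose2 n
  comp+inc {n} P = begin
    comp P + sumFin n (incLater P)
      ≡⟨ cong (_+ sumFin n (incLater P)) (sum-symmetrize n (λ i j → ⟦ lt P i j ⟧) (λ i → cong ⟦_⟧ (irrefl P i))) ⟩
    sumFin n (λ i → sumFin n (λ j → ⟦ i ≺ j ⟧ * (⟦ lt P i j ⟧ + ⟦ lt P j i ⟧))) + sumFin n (incLater P)
      ≡⟨ sym (sum-+ n _ _) ⟩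
    sumFin n (λ i → sumFin n (λ j → ⟦ i ≺ j ⟧ * (⟦ lt P i j ⟧ + ⟦ lt P j i ⟧)) + incLater P i)
      ≡⟨ sum-cong n (λ i → ≡.trans (sym (sum-+ n _ _)) (sum-cong n (pair i))) ⟩
    sumFin n (λ i → sumFin n (λ j → ⟦ i ≺ j ⟧))
      ≡⟨ sum-sum-≺ n ⟩
    choose2 n ∎
    where
    open ≡-Reasoning
    pair : ∀ i j → ⟦ i ≺ j ⟧ * (⟦ lt P i j ⟧ + ⟦ lt P j i ⟧) + ⟦ i ≺ j ∧ inc P i j ⟧ ≡ ⟦ i ≺ j ⟧
    pair i j with i ≺ j | lt P i j in i<j | lt P j i in j<i
    ... | false | _     | _     = refl
    ... | true  | true  | false = refl
    ... | true  | false | true  = refl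
    ... | true  | false | false = refl
    ... | true  | true  | true  with ≡.trans (sym (trans P i j i i<j j<i)) (irrefl P i)
    ...   | ()

  -- Upper bound for posets with few incomparable pairs

  incLater≤ : ∀ {n} (P : Poset n) i → suc (incLater P i) ≤ n ∸ toℕ i
  incLater≤ {n} P i = m+n≤o⇒m≤o∸n (suc (incLater P i)) (begin
    suc (incLater P i) + toℕ i                      ≡⟨ sym (+-suc (incLater P i) (toℕ i)) ⟩
    incLater P i + suc (toℕ i)                      ≤⟨ +-monoˡ-≤ (suc (toℕ i)) (sum-mono n (λ j → ⟦∧⟧≤ (i ≺ j) (inc P i j))) ⟩
    sumFin n (λ j → ⟦ i ≺ j ⟧) + suc (toℕ i)        ≡⟨ sum-≺ n i ⟩
    n                                               ∎)
    where
    open ≤-Reasoning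
    ⟦∧⟧≤ : ∀ a b → ⟦ a ∧ b ⟧ ≤ ⟦ a ⟧
    ⟦∧⟧≤ true  b = ⟦⟧≤1 b
    ⟦∧⟧≤ false b = z≤n

  e-upper : ∀ p r t n (P : Poset n) → t * t * p + r < 2 * t * r → gThreshold r t ≤ n →
            r * sumFin n (incLater P) ≤ p * choose2 n → gDen p r t ^ n * e P < gNum p r t ^ n * n !
  e-upper p r t n P gap N≤n few = ≤-<-trans (*-monoʳ-≤ (gDen p r t ^ n) (e≤prod-incLater n P))
    (prod-small p r t n _ gap N≤n (incLater≤ P) (begin
      r * sumFin n (suc ∘ incLater P)              ≡⟨ cong (r *_) (sum-suc n (incLater P)) ⟩
      r * (n + sumFin n (incLater P))              ≡⟨ *-distribˡ-+ r n _ ⟩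
      r * n + r * sumFin n (incLater P)            ≤⟨ +-monoʳ-≤ (r * n) few ⟩
      r * n + p * choose2 n                        ∎))
    where open ≤-Reasoning

  -- Lower bound for posets with few comparable pairs

  up≤ : ∀ {n} (P : Poset n) i → up P i ≤ n
  up≤ {suc n} P i = s≤s (begin
    sumFin (suc n) (λ j → ⟦ lt P i j ⟧)                      ≡⟨ sum-punchIn n i (λ j → ⟦ lt P i j ⟧) ⟩
    ⟦ lt P i i ⟧ + sumFin n (λ j → ⟦ lt P i (punchIn i j) ⟧) ≡⟨ cong (λ b → ⟦ b ⟧ + sumFin n (λ j → ⟦ lt P i (punchIn i j) ⟧)) (irrefl P i) ⟩
    sumFin n (λ j → ⟦ lt P i (punchIn i j) ⟧)                ≤⟨ sum-mono n (λ j → ⟦⟧≤1 (lt P i (punchIn i j))) ⟩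
    sumFin n (λ _ → 1)                                       ≡⟨ ≡.trans (sum-const n 1) (*-identityʳ n) ⟩
    n                                                        ∎)
    where open ≤-Reasoning

  -- Listing the points along a linear extension, the i-th up-set has at most n − i elements.
  up-sorted : ∀ n (P : Poset n) → ∃ λ (d : Fin n → ℕ) → (∀ i → d i ≤ n ∸ toℕ i) ×
              sumFin n d ≡ sumFin n (up P) × prodFin n d ≡ prodFin n (up P)
  up-sorted zero    P = (λ ()) , (λ ()) , refl , refl
  up-sorted (suc n) P with minimal-below P zero
  ... | i , min , _ with up-sorted n (P − i)
  ...   | d , d≤ , Σd , Πd = up P i ◂ d , bound , sums , ≡.trans (cong (up P i *_) Πd) (sym (prod-up P min))
    where
    bound : ∀ j → (up P i ◂ d) j ≤ suc n ∸ toℕ j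
    bound zero    = up≤ P i
    bound (suc j) = d≤ j

    sums : up P i + sumFin n d ≡ sumFin (suc n) (up P)
    sums = ≡.trans (cong (up P i +_) (≡.trans Σd (sum-cong n (λ j → sym (up-punchIn P min j)))))
                   (sym (sum-punchIn n i (up P)))

  e-lower : ∀ p r t n (P : Poset n) → t * t * p + r < 2 * t * r → gThreshold r t ≤ n →
            r * comp P ≤ p * choose2 n → gDen p r t ^ n < gNum p r t ^ n * e P
  e-lower p r t n P gap N≤n few with up-sorted n P
  ... | d , d≤ , Σd , Πd = *-cancelʳ-< (prodFin n (up P)) _ _ (begin-strict
    gDen p r t ^ n * prodFin n (up P)         ≡⟨ cong (gDen p r t ^ n *_) (sym Πd) ⟩
    gDen p r t ^ n * prodFin n d              <⟨ prod-small p r t n d gap N≤n d≤ Σd≤ ⟩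
    gNum p r t ^ n * n !                      ≤⟨ *-monoʳ-≤ (gNum p r t ^ n) (factorial≤e*prod-up n P) ⟩
    gNum p r t ^ n * (e P * prodFin n (up P)) ≡⟨ sym (*-assoc (gNum p r t ^ n) (e P) _) ⟩
    gNum p r t ^ n * e P * prodFin n (up P)   ∎)
    where
    open ≤-Reasoning
    Σd≤ : r * sumFin n d ≤ r * n + p * choose2 n
    Σd≤ = begin
      r * sumFin n d               ≡⟨ cong (r *_) (≡.trans Σd (sum-suc n _)) ⟩
      r * (n + comp P)             ≡⟨ *-distribˡ-+ r n (comp P) ⟩
      r * n + r * comp P           ≤⟨ +-monoʳ-≤ (r * n) few ⟩
      r * n + p * choose2 n        ∎

  -- Disjoint chains and their complementary weak orders

  <ᵇ-true⁻ : ∀ {m n} → (m <ᵇ n) ≡ true → m < n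
  <ᵇ-true⁻ {m} {n} eq = <ᵇ⇒< m n (subst Bool.T (sym eq) tt)

  T⇒true : ∀ {b} → Bool.T b → b ≡ true
  T⇒true {true} _ = refl

  <ᵇ-true⁺ : ∀ {m n} → m < n → (m <ᵇ n) ≡ true
  <ᵇ-true⁺ m<n = T⇒true (<⇒<ᵇ m<n)

  <ᵇ-irrefl : ∀ n → (n <ᵇ n) ≡ false
  <ᵇ-irrefl zero    = refl
  <ᵇ-irrefl (suc n) = <ᵇ-irrefl n

  <ᵇ-trans : ∀ l m n → (l <ᵇ m) ≡ true → (m <ᵇ n) ≡ true → (l <ᵇ n) ≡ true
  <ᵇ-trans l m n l<m m<n = <ᵇ-true⁺ (<-trans (<ᵇ-true⁻ {l} {m} l<m) (<ᵇ-true⁻ {m} {n} m<n))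

  ≡ᵇ-true⁻ : ∀ {m n} → (m ≡ᵇ n) ≡ true → m ≡ n
  ≡ᵇ-true⁻ {m} {n} eq = ≡ᵇ⇒≡ m n (subst Bool.T (sym eq) tt)

  ≡ᵇ-true⁺ : ∀ {m n} → m ≡ n → (m ≡ᵇ n) ≡ true
  ≡ᵇ-true⁺ {m} {n} m≡n = T⇒true (≡⇒≡ᵇ m n m≡n)

  ≮∧≯⇔≡ : ∀ m n → not (m <ᵇ n) ∧ not (n <ᵇ m) ≡ (m ≡ᵇ n)
  ≮∧≯⇔≡ zero    zero    = refl
  ≮∧≯⇔≡ zero    (suc n) = refl
  ≮∧≯⇔≡ (suc m) zero    = refl
  ≮∧≯⇔≡ (suc m) (suc n) = ≮∧≯⇔≡ m n

  module _ (H : ℕ → ℕ) (n : ℕ) where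

    chains : Poset n
    chains = record
      { lt     = λ i j → (H (toℕ i) ≡ᵇ H (toℕ j)) ∧ i ≺ j
      ; irrefl = λ i → ≡.trans (cong ((H (toℕ i) ≡ᵇ H (toℕ i)) ∧_) (<ᵇ-irrefl (toℕ i))) (Bool.∧-zeroʳ _)
      ; trans  = tr
      }
      where
      tr : ∀ i j k → (H (toℕ i) ≡ᵇ H (toℕ j)) ∧ i ≺ j ≡ true → (H (toℕ j) ≡ᵇ H (toℕ k)) ∧ j ≺ k ≡ true →
           (H (toℕ i) ≡ᵇ H (toℕ k)) ∧ i ≺ k ≡ true
      tr i j k i<j j<k with ∧-true {H (toℕ i) ≡ᵇ H (toℕ j)} i<j | ∧-true {H (toℕ j) ≡ᵇ H (toℕ k)} j<k
      ... | a , b | c , d = cong₂ _∧_ (≡ᵇ-true⁺ (≡.trans (≡ᵇ-true⁻ {H (toℕ i)} a) (≡ᵇ-true⁻ {H (toℕ j)} c)))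
                                      (<ᵇ-trans (toℕ i) (toℕ j) (toℕ k) b d)

    levels : Poset n
    levels = record
      { lt     = λ i j → H (toℕ i) <ᵇ H (toℕ j)
      ; irrefl = λ i → <ᵇ-irrefl (H (toℕ i))
      ; trans  = λ i j k → <ᵇ-trans (H (toℕ i)) (H (toℕ j)) (H (toℕ k))
      }

    levels-weak : Weak levels
    levels-weak i j k inc-ij k<i = subst (λ h → (H (toℕ k) <ᵇ h) ≡ true)
      (≡ᵇ-true⁻ {H (toℕ i)} (≡.trans (sym (≮∧≯⇔≡ (H (toℕ i)) (H (toℕ j)))) inc-ij)) k<i

    -- Both sides count the points from `i` onwards in the fibre of `H` through `i`. Hence the
    -- product in the lower bound for `e chains` equals, factor by factor, the one for `e levels`.
    incLater-levels : ∀ i → suc (incLater levels i) ≡ up chains i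
    incLater-levels i = cong suc (sum-cong n (λ j → cong ⟦_⟧
      (≡.trans (cong (i ≺ j ∧_) (≮∧≯⇔≡ (H (toℕ i)) (H (toℕ j)))) (Bool.∧-comm (i ≺ j) _))))

    factorial≤e*e : n ! ≤ e chains * e levels
    factorial≤e*e = ≤-trans (factorial≤e*prod-up n chains) (*-monoʳ-≤ (e chains)
      (≤-trans (≤-reflexive (sym (prod-cong n incLater-levels))) (weak-prod-incLater≤e n levels levels-weak)))

    comp-levels+comp-chains : comp levels + comp chains ≡ choose2 n
    comp-levels+comp-chains = ≡.trans
      (cong (comp levels +_) (sum-cong n (λ i → suc-injective (sym (incLater-levels i)))))
      (comp+inc levels)

    chains-partition : ∀ {k} (h : Fin n → Fin k) → (∀ i → toℕ (h i) ≡ H (toℕ i)) → ChainPartition chains h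
    chains-partition h h≡H i j hi≡hj i≢j = by-order (<-cmp (toℕ i) (toℕ j))
      where
      Hi≡Hj : H (toℕ i) ≡ H (toℕ j)
      Hi≡Hj = ≡.trans (sym (h≡H i)) (≡.trans (cong toℕ hi≡hj) (h≡H j))

      by-order : Tri (toℕ i < toℕ j) (toℕ i ≡ toℕ j) (toℕ i > toℕ j) →
                 lt chains i j ≡ true ⊎ lt chains j i ≡ true
      by-order (tri< i<j _ _) = inj₁ (cong₂ _∧_ (≡ᵇ-true⁺ Hi≡Hj) (<ᵇ-true⁺ i<j))
      by-order (tri≈ _ i≡j _) = contradiction (toℕ-injective i≡j) i≢j
      by-order (tri> _ _ j<i) = inj₂ (cong₂ _∧_ (≡ᵇ-true⁺ (sym Hi≡Hj)) (<ᵇ-true⁺ j<i))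

  cnt : (ℕ → ℕ) → ℕ → ℕ
  cnt f m = sumFin m (f ∘ toℕ)

  sum-below : ∀ n (j : Fin n) (q : ℕ → Bool) → sumFin n (λ i → ⟦ q (toℕ i) ∧ i ≺ j ⟧) ≡ cnt (⟦_⟧ ∘ q) (toℕ j)
  sum-below (suc n) zero    q = ≡.trans (sum-cong (suc n) (λ i → cong ⟦_⟧ (Bool.∧-zeroʳ (q (toℕ i))))) (sum-zero (suc n))
  sum-below (suc n) (suc j) q = cong₂ _+_ (cong ⟦_⟧ (Bool.∧-identityʳ (q 0))) (sum-below n j (q ∘ suc))

  -- Each comparable pair is counted at its later point m, and the numbers m add up to C(n,2). A
  -- density bound A / B before every m thus carries over to comparable pairs without any error
  -- term.
  comp-chains≤ : ∀ H A B → (∀ m → B * cnt (λ l → ⟦ H l ≡ᵇ H m ⟧) m ≤ A * m) →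
                 ∀ n → B * comp (chains H n) ≤ A * choose2 n
  comp-chains≤ H A B bound n = begin
    B * comp (chains H n)
      ≡⟨ cong (B *_) (≡.trans (sum-swap n n _) (sum-cong n (λ j → sum-below n j (λ m → H m ≡ᵇ H (toℕ j))))) ⟩
    B * sumFin n (λ j → cnt (λ l → ⟦ H l ≡ᵇ H (toℕ j) ⟧) (toℕ j))
      ≡⟨ sym (sum-*ˡ n B _) ⟩
    sumFin n (λ j → B * cnt (λ l → ⟦ H l ≡ᵇ H (toℕ j) ⟧) (toℕ j))
      ≤⟨ sum-mono n (λ j → bound (toℕ j)) ⟩
    sumFin n (λ j → A * toℕ j)
      ≡⟨ ≡.trans (sum-*ˡ n A toℕ) (cong (A *_) (sum-toℕ n)) ⟩
    A * choose2 n ∎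
    where open ≤-Reasoning

  -- Counting in residue classes

  cnt-+ : ∀ f k m → cnt f (k + m) ≡ cnt f k + cnt (λ l → f (k + l)) m
  cnt-+ f zero    m = refl
  cnt-+ f (suc k) m = ≡.trans (cong (f 0 +_) (cnt-+ (f ∘ suc) k m)) (sym (+-assoc (f 0) _ _))

  cnt-periodic : ∀ f k → (∀ l → f (k + l) ≡ f l) → ∀ q c → cnt f (q * k + c) ≡ q * cnt f k + cnt f c
  cnt-periodic f k per zero    c = refl
  cnt-periodic f k per (suc q) c = begin
    cnt f (k + q * k + c)                              ≡⟨ cong (cnt f) (+-assoc k (q * k) c) ⟩
    cnt f (k + (q * k + c))                            ≡⟨ cnt-+ f k (q * k + c) ⟩
    cnt f k + cnt (λ l → f (k + l)) (q * k + c)        ≡⟨ cong (cnt f k +_) (sum-cong (q * k + c) (λ i → per (toℕ i))) ⟩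
    cnt f k + cnt f (q * k + c)                        ≡⟨ cong (cnt f k +_) (cnt-periodic f k per q c) ⟩
    cnt f k + (q * cnt f k + cnt f c)                  ≡⟨ sym (+-assoc (cnt f k) _ _) ⟩
    cnt f k + q * cnt f k + cnt f c                    ∎
    where open ≡-Reasoning

  module _ (k : ℕ) {{_ : NonZero k}} where

    [k+l]%k : ∀ l → (k + l) % k ≡ l % k
    [k+l]%k l = ≡.trans (cong (_% k) (+-comm k l)) ([m+n]%n≡m%n l k)

    cnt-divMod : ∀ f → (∀ l → f (k + l) ≡ f l) → ∀ m → cnt f m ≡ m / k * cnt f k + cnt f (m % k)
    cnt-divMod f per m = ≡.trans (cong (cnt f) m≡) (cnt-periodic f k per (m / k) (m % k))
      where
      m≡ : m ≡ m / k * k + m % k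
      m≡ = ≡.trans (m≡m%n+[m/n]*n m k) (+-comm (m % k) _)

    -- Before m there are exactly ⌊m / k⌋ elements of the residue class of m.
    cnt-residue : ∀ m → k * cnt (λ l → ⟦ l % k ≡ᵇ m % k ⟧) m ≤ 1 * m
    cnt-residue m = begin
      k * cnt f m                                 ≡⟨ cong (k *_) (cnt-divMod f (λ l → cong (λ x → ⟦ x ≡ᵇ m % k ⟧) ([k+l]%k l)) m) ⟩
      k * (m / k * cnt f k + cnt f (m % k))       ≤⟨ *-monoʳ-≤ k (+-mono-≤ (*-monoʳ-≤ (m / k) block) (≤-reflexive rest)) ⟩
      k * (m / k * 1 + 0)                         ≡⟨ regroup k (m / k) ⟩
      m / k * k                                   ≤⟨ m≤n+m _ (m % k) ⟩
      m % k + m / k * k                           ≡⟨ sym (≡.trans (+-identityʳ m) (m≡m%n+[m/n]*n m k)) ⟩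
      1 * m                                       ∎
      where
      open ≤-Reasoning
      f : ℕ → ℕ
      f l = ⟦ l % k ≡ᵇ m % k ⟧

      regroup : ∀ k q → k * (q * 1 + 0) ≡ q * k
      regroup = solve-∀

      residue : ∀ {l} → l < k → (l % k ≡ᵇ m % k) ≡ true → l ≡ m % k
      residue l<k eq = ≡.trans (sym (m<n⇒m%n≡m l<k)) (≡ᵇ-true⁻ eq)

      block : cnt f k ≤ 1
      block = sum-⟦⟧≤1 k (λ i → toℕ i % k ≡ᵇ m % k) (λ i j ei ej →
        toℕ-injective (≡.trans (residue (toℕ<n i) ei) (sym (residue (toℕ<n j) ej))))

      rest : cnt f (m % k) ≡ 0
      rest = ≡.trans (sum-cong (m % k) (λ i → cong ⟦_⟧ (¬-not (λ eq →
        <⇒≢ (toℕ<n i) (residue (<-trans (toℕ<n i) (m%n<n m k)) eq))))) (sum-zero (m % k))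

  module _ (s′ : ℕ) where

    private
      s = suc s′

    multiple : ℕ → ℕ
    multiple m = ⟦ m % s ≡ᵇ 0 ⟧

    private
      cnt-prefix : ∀ c → suc c ≤ s → cnt multiple (suc c) ≡ 1
      cnt-prefix c c<s = cong suc (≡.trans
        (sum-cong c (λ i → cong (λ x → ⟦ x ≡ᵇ 0 ⟧) (m<n⇒m%n≡m (≤-trans (s≤s (toℕ<n i)) c<s))))
        (sum-zero c))

      s*cnt-prefix : ∀ c → suc c ≤ s → s * cnt multiple (suc c) ≡ s
      s*cnt-prefix c c<s = ≡.trans (cong (s *_) (cnt-prefix c c<s)) (*-identityʳ s)

      cnt-multiple : ∀ m → cnt multiple m ≡ m / s + cnt multiple (m % s)
      cnt-multiple m = ≡.trans (cnt-divMod s multiple (λ l → cong (λ x → ⟦ x ≡ᵇ 0 ⟧) ([k+l]%k s l)) m)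
        (cong (_+ cnt multiple (m % s)) (≡.trans (cong (m / s *_) (cnt-prefix s′ ≤-refl)) (*-identityʳ (m / s))))

      m≡s*q+c : ∀ m → m ≡ s * (m / s) + m % s
      m≡s*q+c m = ≡.trans (m≡m%n+[m/n]*n m s) (≡.trans (+-comm (m % s) _) (cong (_+ m % s) (*-comm (m / s) s)))

    s*cnt-multiple : ∀ m → s * cnt multiple m ≡ s * (m / s) + s * cnt multiple (m % s)
    s*cnt-multiple m = ≡.trans (cong (s *_) (cnt-multiple m)) (*-distribˡ-+ s (m / s) _)

    m≤s*cnt : ∀ m → m ≤ s * cnt multiple m
    m≤s*cnt m = begin
      m                                              ≡⟨ m≡s*q+c m ⟩
      s * (m / s) + m % s                            ≤⟨ +-monoʳ-≤ (s * (m / s)) (c≤ (m % s) (m%n<n m s)) ⟩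
      s * (m / s) + s * cnt multiple (m % s)         ≡⟨ sym (s*cnt-multiple m) ⟩
      s * cnt multiple m                             ∎
      where
      open ≤-Reasoning
      c≤ : ∀ c → c < s → c ≤ s * cnt multiple c
      c≤ zero    _   = z≤n
      c≤ (suc c) c<s = ≤-trans (<⇒≤ c<s) (≤-reflexive (sym (s*cnt-prefix c (<⇒≤ c<s))))

    s*cnt≤m+s : ∀ m → s * cnt multiple m ≤ m + s
    s*cnt≤m+s m = begin
      s * cnt multiple m                             ≡⟨ s*cnt-multiple m ⟩
      s * (m / s) + s * cnt multiple (m % s)         ≤⟨ +-mono-≤ (≤-trans (m≤m+n _ (m % s)) (≤-reflexive (sym (m≡s*q+c m)))) (≤s (m % s) (m%n<n m s)) ⟩
      m + s                                          ∎
      where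
      open ≤-Reasoning
      ≤s : ∀ c → c < s → s * cnt multiple c ≤ s
      ≤s zero    _   rewrite *-zeroʳ s = z≤n
      ≤s (suc c) c<s = ≤-reflexive (s*cnt-prefix c (<⇒≤ c<s))

    s*cnt≡m : ∀ m → m % s ≡ 0 → s * cnt multiple m ≡ m
    s*cnt≡m m m%s≡0 = ≡.trans (s*cnt-multiple m) (≡.trans
      (cong (s * (m / s) +_) (≡.trans (cong (λ c → s * cnt multiple c) m%s≡0) (≡.trans (*-zeroʳ s) (sym m%s≡0))))
      (sym (m≡s*q+c m)))

    -- There are ⌈m / s⌉ multiples of s before m. If m is not a multiple, the rounding helps,
    -- leaving at most m - m / s others. If m is a multiple, the count is exactly m / s, which is at
    -- most (s - 1) m / s because s ≥ 2.
    cnt-multiple-class : 1 ≤ s′ → ∀ m → s * cnt (λ l → ⟦ multiple l ≡ᵇ multiple m ⟧) m ≤ s′ * m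
    cnt-multiple-class 1≤s′ m with m % s ≡ᵇ 0 in eq
    ... | true  = begin
      s * cnt (λ l → ⟦ multiple l ≡ᵇ 1 ⟧) m      ≡⟨ cong (s *_) (sum-cong m (λ i → idem (toℕ i % s ≡ᵇ 0))) ⟩
      s * cnt multiple m                         ≡⟨ s*cnt≡m m (≡ᵇ-true⁻ eq) ⟩
      m                                          ≡⟨ sym (+-identityʳ m) ⟩
      1 * m                                      ≤⟨ *-monoˡ-≤ m 1≤s′ ⟩
      s′ * m                                     ∎
      where
      open ≤-Reasoning
      idem : ∀ b → ⟦ ⟦ b ⟧ ≡ᵇ 1 ⟧ ≡ ⟦ b ⟧
      idem true  = refl
      idem false = refl
    ... | false = +-cancelʳ-≤ m _ _ (begin
      s * others + m                             ≤⟨ +-monoʳ-≤ (s * others) (m≤s*cnt m) ⟩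
      s * others + s * cnt multiple m            ≡⟨ sym (*-distribˡ-+ s others _) ⟩
      s * (others + cnt multiple m)              ≡⟨ cong (s *_) (≡.trans (sym (sum-+ m _ _)) (sum-cong m (λ i → compl (toℕ i % s ≡ᵇ 0)))) ⟩
      s * sumFin m (λ _ → 1)                     ≡⟨ cong (s *_) (≡.trans (sum-const m 1) (*-identityʳ m)) ⟩
      s * m                                      ≡⟨ +-comm m (s′ * m) ⟩
      s′ * m + m                                 ∎)
      where
      open ≤-Reasoning
      others = cnt (λ l → ⟦ multiple l ≡ᵇ 0 ⟧) m
      compl : ∀ b → ⟦ ⟦ b ⟧ ≡ᵇ 0 ⟧ + ⟦ b ⟧ ≡ 1
      compl true  = refl
      compl false = refl

  -- Chains with few comparable pairs and few linear extensions

  prod-^ : ∀ x n (b : Fin n → Bool) → prodFin n (λ i → if b i then 1 else x) * x ^ sumFin n (⟦_⟧ ∘ b) ≡ x ^ n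
  prod-^ x zero    b = refl
  prod-^ x (suc n) b with b zero
  ... | true  = ≡.trans (regroup x (prodFin n (λ i → if b (suc i) then 1 else x)) (x ^ sumFin n (⟦_⟧ ∘ b ∘ suc))) (cong (x *_) (prod-^ x n (b ∘ suc)))
    where
    regroup : ∀ x p q → 1 * p * (x * q) ≡ x * (p * q)
    regroup = solve-∀
  ... | false = ≡.trans (*-assoc x _ _) (cong (x *_) (prod-^ x n (b ∘ suc)))

  prod-1 : ∀ n → prodFin n (λ _ → 1) ≡ 1
  prod-1 zero    = refl
  prod-1 (suc n) = ≡.trans (+-identityʳ _) (prod-1 n)

  e-residue-chains : ∀ k {{_ : NonZero k}} n → e (chains (_% k) n) ≤ k ^ n
  e-residue-chains k n = begin
    e P                                      ≡⟨ sym (*-identityʳ (e P)) ⟩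
    e P * 1                                  ≡⟨ cong (e P *_) (sym (prod-1 n)) ⟩
    e P * prodFin n (λ _ → 1)                ≤⟨ e*prod-weights≤ n k P h (chains-partition (_% k) n h (λ i → toℕ-fromℕ< _)) (λ _ → 1) ⟩
    sumFin k (λ _ → 1) ^ n                   ≡⟨ cong (_^ n) (≡.trans (sum-const k 1) (*-identityʳ k)) ⟩
    k ^ n                                    ∎
    where
    open ≤-Reasoning
    P = chains (_% k) n
    h : Fin n → Fin k
    h i = fromℕ< (m%n<n (toℕ i) k)

  -- Points of the large chain get weight t and the multiples weight 1, for a total of t + 1. Both
  -- sides carry an extra factor t ^ m, where m is the number of multiples, to avoid the exponent n
  -- - m.
  e-multiple-chains : ∀ s′ t n → e (chains (multiple s′) n) * t ^ n ≤ suc t ^ n * t ^ cnt (multiple s′) n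
  e-multiple-chains s′ t n = begin
    e P * t ^ n                                             ≡⟨ cong (e P *_) (sym (prod-^ t n b)) ⟩
    e P * (prodFin n (λ i → if b i then 1 else t) * T′)     ≡⟨ sym (*-assoc (e P) _ T′) ⟩
    e P * prodFin n (λ i → if b i then 1 else t) * T′       ≡⟨ cong (λ x → e P * x * T′) (prod-cong n (λ i → weight (b i))) ⟩
    e P * prodFin n (w ∘ h) * T′                            ≤⟨ *-monoˡ-≤ T′ (e*prod-weights≤ n 2 P h (chains-partition (multiple s′) n h (λ i → class (b i))) w) ⟩
    (t + 1) ^ n * T′                                        ≡⟨ cong (λ x → x ^ n * T′) (+-comm t 1) ⟩
    suc t ^ n * T′                                          ∎
    where
    open ≤-Reasoning
    P  = chains (multiple s′) n
    T′ = t ^ cnt (multiple s′) n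

    b : Fin n → Bool
    b i = toℕ i % suc s′ ≡ᵇ 0

    w : Fin 2 → ℕ
    w zero    = t
    w (suc _) = 1

    h : Fin n → Fin 2
    h i = if b i then suc zero else zero

    weight : ∀ b → (if b then 1 else t) ≡ w (if b then suc zero else zero)
    weight true  = refl
    weight false = refl

    class : ∀ b → toℕ {2} (if b then suc zero else zero) ≡ ⟦ b ⟧
    class true  = refl
    class false = refl

  -- Bernoulli's inequality (1 + 1/t)^j ≥ 1 + j/t at j = t².
  power-gap : ∀ t → 1 ≤ t → t ^ (t * t) * suc t ≤ suc t ^ (t * t)
  power-gap t 1≤t = *-cancelʳ-≤ _ _ t {{>-nonZero 1≤t}} (≤-trans (≤-reflexive (regroup t (t ^ (t * t)))) (go (t * t)))
    where
    open ≤-Reasoning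
    regroup : ∀ t x → x * suc t * t ≡ x * (t + t * t)
    regroup = solve-∀

    go : ∀ j → t ^ j * (t + j) ≤ suc t ^ j * t
    go zero    = ≤-reflexive (cong (1 *_) (+-identityʳ t))
    go (suc j) = begin
      t * t ^ j * (t + suc j)                ≤⟨ m≤m+n _ (t ^ j * j) ⟩
      t * t ^ j * (t + suc j) + t ^ j * j    ≡⟨ expand t j (t ^ j) ⟩
      suc t * (t ^ j * (t + j))              ≤⟨ *-monoʳ-≤ (suc t) (go j) ⟩
      suc t * (suc t ^ j * t)                ≡⟨ sym (*-assoc (suc t) (suc t ^ j) t) ⟩
      suc t * suc t ^ j * t                  ∎
      where
      expand : ∀ t j x → t * x * (t + suc j) + x * j ≡ suc t * (x * (t + j))
      expand = solve-∀

  -- By `power-gap`, (1 + 1/t)^(t² m) ≥ (t + 1)^m > t^m; the other u = 2n - t² m factors 1 + 1/t are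
  -- at least 1. This expresses the cost t^m of the small chain in powers of 1 + 1/t.
  power-gap-cnt : ∀ t n m → 1 ≤ t → 1 ≤ m → t * t * m ≤ 2 * n → t ^ m * t ^ (2 * n) < suc t ^ (2 * n)
  power-gap-cnt t n m@(suc _) 1≤t 1≤m sm≤2n with m≤n⇒∃[o]m+o≡n sm≤2n
  ... | u , eq = begin-strict
    t ^ m * t ^ (2 * n)                                <⟨ *-monoˡ-< (t ^ (2 * n)) {{m^n≢0 t (2 * n) {{>-nonZero 1≤t}}}} (^-monoˡ-< m (n<1+n t)) ⟩
    suc t ^ m * t ^ (2 * n)                            ≡⟨ cong (λ x → suc t ^ m * t ^ x) (sym eq) ⟩
    suc t ^ m * t ^ (s * m + u)                        ≡⟨ cong (suc t ^ m *_) (≡.trans (^-distribˡ-+-* t (s * m) u) (cong (_* t ^ u) (sym (^-*-assoc t s m)))) ⟩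
    suc t ^ m * ((t ^ s) ^ m * t ^ u)                  ≡⟨ regroup (suc t ^ m) ((t ^ s) ^ m) (t ^ u) ⟩
    (t ^ s) ^ m * suc t ^ m * t ^ u                    ≡⟨ cong (_* t ^ u) (sym (^-distribʳ-* m (t ^ s) (suc t))) ⟩
    (t ^ s * suc t) ^ m * t ^ u                        ≤⟨ *-mono-≤ (^-monoˡ-≤ m (power-gap t 1≤t)) (^-monoˡ-≤ u (n≤1+n t)) ⟩
    (suc t ^ s) ^ m * suc t ^ u                        ≡⟨ cong (_* suc t ^ u) (^-*-assoc (suc t) s m) ⟩
    suc t ^ (s * m) * suc t ^ u                        ≡⟨ sym (^-distribˡ-+-* (suc t) (s * m) u) ⟩
    suc t ^ (s * m + u)                                ≡⟨ cong (suc t ^_) eq ⟩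
    suc t ^ (2 * n)                                    ∎
    where
    open ≤-Reasoning
    s = t * t
    regroup : ∀ a b c → a * (b * c) ≡ b * a * c
    regroup = solve-∀

  -- Stores the map `H` instead of a poset because `chains H n` is needed for f⁻ and `levels H n`
  -- for f⁺. The number κ / λ′ bounds the n-th root of e.
  record FewExtensions (p r n κ λ′ : ℕ) : Set where
    constructor few
    field
      H            : ℕ → ℕ
      comp-bounded : r * comp (chains H n) ≤ p * choose2 n
      e-bounded    : λ′ ^ n * e (chains H n) < κ ^ n

  -- Residue classes modulo r have density 1 / r ≤ p / r. Passing from r to r + 1 makes the bound
  -- strict.
  residue-chains : ∀ p r n → 1 ≤ p → 1 ≤ r → 1 ≤ n → FewExtensions p r n (suc r) 1
  residue-chains p r@(suc _) n@(suc _) 1≤p _ _ = few (_% r)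
    (≤-trans (comp-chains≤ (_% r) 1 r (cnt-residue r) n) (*-monoˡ-≤ (choose2 n) 1≤p))
    (begin-strict
      1 ^ n * e (chains (_% r) n)     ≡⟨ cong (_* e (chains (_% r) n)) (^-zeroˡ n) ⟩
      1 * e (chains (_% r) n)         ≡⟨ +-identityʳ _ ⟩
      e (chains (_% r) n)             ≤⟨ e-residue-chains r n ⟩
      r ^ n                           <⟨ ^-monoˡ-< n (n<1+n r) ⟩
      suc r ^ n                       ∎)
    where open ≤-Reasoning

  multiple-chains : ∀ p p′ r t n → p + p′ ≡ r → 2 ≤ t → t * t * p′ ≤ r → t * t ≤ n →
                    FewExtensions p r n (suc t ^ 3) (t ^ 3)
  multiple-chains p p′ r t@(suc (suc _)) n@(suc _) refl (s≤s (s≤s _)) t²p′≤r s≤n = few H comp-bounded e-bounded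
    where
    open ≤-Reasoning
    s′ = pred (t * t)
    s  = suc s′
    H  = multiple s′
    m  = cnt H n

    -- This is 1 - 1/s ≤ p / r, the complementary form of p′ / r ≤ 1/s = 1/t².
    s′r≤sp : s′ * r ≤ s * p
    s′r≤sp = +-cancelʳ-≤ r _ _ (begin
      s′ * r + r        ≡⟨ +-comm (s′ * r) r ⟩
      s * r             ≡⟨ *-distribˡ-+ s p p′ ⟩
      s * p + s * p′    ≤⟨ +-monoʳ-≤ (s * p) t²p′≤r ⟩
      s * p + r         ∎)

    comp-bounded : r * comp (chains H n) ≤ p * choose2 n
    comp-bounded = *-cancelˡ-≤ s (begin
      s * (r * comp (chains H n))       ≡⟨ *-left-comm s r _ ⟩
      r * (s * comp (chains H n))       ≤⟨ *-monoʳ-≤ r (comp-chains≤ H s′ s (cnt-multiple-class s′ (s≤s z≤n)) n) ⟩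
      r * (s′ * choose2 n)              ≡⟨ assoc-comm r s′ (choose2 n) ⟩
      s′ * r * choose2 n                ≤⟨ *-monoˡ-≤ (choose2 n) s′r≤sp ⟩
      s * p * choose2 n                 ≡⟨ *-assoc s p (choose2 n) ⟩
      s * (p * choose2 n)               ∎)
      where
      assoc-comm : ∀ a b c → a * (b * c) ≡ b * a * c
      assoc-comm = solve-∀

    -- Here m = ⌈n / s⌉, and rounding up costs at most s ≤ n.
    sm≤2n : t * t * m ≤ 2 * n
    sm≤2n = ≤-trans (s*cnt≤m+s s′ n) (+-monoʳ-≤ n (≤-trans s≤n (≤-reflexive (sym (+-identityʳ n)))))

    -- The cube is one factor 1 + 1/t from the total weight t + 1 and two that absorb t^m, as t² m ≤
    -- 2n.
    e-bounded : (t ^ 3) ^ n * e (chains H n) < (suc t ^ 3) ^ n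
    e-bounded = begin-strict
      (t ^ 3) ^ n * e (chains H n)              ≡⟨ cong (_* e (chains H n)) (cube t) ⟩
      t ^ n * t ^ (2 * n) * e (chains H n)      ≡⟨ rotate (t ^ n) (t ^ (2 * n)) (e (chains H n)) ⟩
      e (chains H n) * t ^ n * t ^ (2 * n)      ≤⟨ *-monoˡ-≤ (t ^ (2 * n)) (e-multiple-chains s′ t n) ⟩
      suc t ^ n * t ^ m * t ^ (2 * n)           ≡⟨ *-assoc (suc t ^ n) (t ^ m) _ ⟩
      suc t ^ n * (t ^ m * t ^ (2 * n))         <⟨ *-monoʳ-< (suc t ^ n) {{m^n≢0 (suc t) n}} (power-gap-cnt t n m (s≤s z≤n) (s≤s z≤n) sm≤2n) ⟩
      suc t ^ n * suc t ^ (2 * n)               ≡⟨ sym (cube (suc t)) ⟩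
      (suc t ^ 3) ^ n                           ∎
      where
      cube : ∀ x → (x ^ 3) ^ n ≡ x ^ n * x ^ (2 * n)
      cube x = ≡.trans (^-*-assoc x 3 n) (^-distribˡ-+-* x n (2 * n))
      rotate : ∀ a b c → a * b * c ≡ c * a * b
      rotate = solve-∀

  -- kNum / kDen bounds e^(1/n) for the chains with at most p C(n,2) / r comparable pairs, where p = r − p′;
  -- for root p′ r < 2 the two-chain construction is unavailable and residue classes modulo r are used.
  kNum kDen kThreshold : ℕ → ℕ → ℕ
  kNum p′ r with 2 ≤? root p′ r
  ... | yes _ = suc (root p′ r) ^ 3
  ... | no  _ = suc r
  kDen p′ r with 2 ≤? root p′ r
  ... | yes _ = root p′ r ^ 3
  ... | no  _ = 1
  kThreshold p′ r with 2 ≤? root p′ r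
  ... | yes _ = root p′ r * root p′ r
  ... | no  _ = 1

  few-extensions : ∀ p p′ r n → p + p′ ≡ r → 1 ≤ p → kThreshold p′ r ≤ n → FewExtensions p r n (kNum p′ r) (kDen p′ r)
  few-extensions p p′ r n p+p′≡r 1≤p N≤n with 2 ≤? root p′ r
  ... | yes 2≤t = multiple-chains p p′ r (root p′ r) n p+p′≡r 2≤t (root-sound p′ r) N≤n
  ... | no  _   = residue-chains p r n 1≤p (≤-trans 1≤p (≤-trans (m≤m+n p p′) (≤-reflexive p+p′≡r))) N≤n

  -- The theorem over ℕ, with δ = u / r and 1 − δ = w / r

  ^-cancelˡ-< : ∀ n a b → a ^ n < b ^ n → a < b
  ^-cancelˡ-< n a b aⁿ<bⁿ with a <? b
  ... | yes a<b = a<b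
  ... | no  a≮b = contradiction aⁿ<bⁿ (≤⇒≯ (^-monoˡ-≤ n (≮⇒≥ a≮b)))

  gN gD gT : ℕ → ℕ → ℕ
  gN p r = gNum p r (root p r)
  gD p r = gDen p r (root p r)
  gT p r = gThreshold r (root p r)

  g-gap-root : ∀ p r → 1 ≤ p → p < r → root p r * root p r * p + r < 2 * root p r * r
  g-gap-root p r 1≤p p<r = g-gap p r (root p r) (1≤root p r 1≤p (<⇒≤ p<r)) (root-sound p r) p<r

  gN<gD : ∀ p r → 1 ≤ p → p < r → gN p r < gD p r
  gN<gD p r 1≤p p<r = begin-strict
    t * (t * t * p + r) + 2 * t * r      <⟨ +-monoˡ-< (2 * t * r) (*-monoʳ-< t {{>-nonZero (1≤root p r 1≤p (<⇒≤ p<r))}} (g-gap-root p r 1≤p p<r)) ⟩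
    t * (2 * t * r) + 2 * t * r          ≡⟨ collect t (2 * t * r) ⟩
    2 * t * r * suc t                    ∎
    where
    open ≤-Reasoning
    t = root p r
    collect : ∀ t b → t * b + b ≡ b * suc t
    collect = solve-∀

  module _ (p r : ℕ) (1≤p : 1 ≤ p) (p<r : p < r) where

    private
      instance
        root≢0 : NonZero (root p r)
        root≢0 = >-nonZero (1≤root p r 1≤p (<⇒≤ p<r))
        r≢0 : NonZero r
        r≢0 = >-nonZero (≤-trans (s≤s z≤n) p<r)

    1≤gN : 1 ≤ gN p r
    1≤gN = ≤-trans (>-nonZero⁻¹ (2 * root p r * r) {{m*n≢0 (2 * root p r) r {{m*n≢0 2 (root p r)}}}}) (m≤n+m _ (root p r * (root p r * root p r * p + r)))

    -- From t² p ≤ r it follows that c ≤ 1/t and g ≤ 4 t r / (2 t r (t + 1)) = 2 / (t + 1).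
    gN*v<gD : ∀ v → 2 * v ≤ root p r → gN p r * v < gD p r
    gN*v<gD v 2v≤t = begin-strict
      (t * (t * t * p + r) + 2 * t * r) * v    ≤⟨ *-monoˡ-≤ v (+-monoˡ-≤ (2 * t * r) (*-monoʳ-≤ t (+-monoˡ-≤ r (root-sound p r)))) ⟩
      (t * (r + r) + 2 * t * r) * v            ≡⟨ collect t r v ⟩
      2 * t * r * (2 * v)                      <⟨ *-monoʳ-< (2 * t * r) {{m*n≢0 (2 * t) r {{m*n≢0 2 t}}}} (s≤s 2v≤t) ⟩
      2 * t * r * suc t                        ∎
      where
      open ≤-Reasoning
      t = root p r
      collect : ∀ t r v → (t * (r + r) + 2 * t * r) * v ≡ 2 * t * r * (2 * v)
      collect = solve-∀

  1≤kN : ∀ p r → 1 ≤ kNum p r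
  1≤kN p r with 2 ≤? root p r
  ... | yes _ = m^n>0 (suc (root p r)) 3
  ... | no  _ = s≤s z≤n

  1≤kD : ∀ p r → 1 ≤ kDen p r
  1≤kD p r with 2 ≤? root p r
  ... | yes 2≤t = m^n>0 (root p r) {{>-nonZero (<⇒≤ 2≤t)}} 3
  ... | no  _   = s≤s z≤n

  -- The claim is (1 + 1/t)³ < 1 + 1/v. Since (t + 1)³ - t³ = 3t² + 3t + 1 ≤ 7t², it follows from 7v
  -- < t. The summand 2 in the hypothesis also guarantees t ≥ 2, hence the two-chain branch of
  -- `kNum` and `kDen`.
  kN-small : ∀ p r v → 7 * v + 2 ≤ root p r → kNum p r * v < kDen p r * v + kDen p r
  kN-small p r v T≤t with 2 ≤? root p r
  ... | no  2≰t = contradiction (≤-trans (m≤n+m 2 (7 * v)) T≤t) 2≰t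
  ... | yes 2≤t = begin-strict
    suc t ^ 3 * v                                         ≡⟨ expand t v ⟩
    t ^ 3 * v + v * (3 * (t * t) + 3 * t + 1)             ≤⟨ +-monoʳ-≤ (t ^ 3 * v) (*-monoʳ-≤ v (+-mono-≤ (+-monoʳ-≤ (3 * (t * t)) (*-monoʳ-≤ 3 t≤t²)) 1≤t²)) ⟩
    t ^ 3 * v + v * (3 * (t * t) + 3 * (t * t) + t * t)   ≡⟨ cong (t ^ 3 * v +_) (collect t v) ⟩
    t ^ 3 * v + 7 * v * (t * t)                           <⟨ +-monoʳ-< (t ^ 3 * v) (*-monoˡ-< (t * t) {{m*n≢0 t t}} (≤-trans (≤-trans (≤-reflexive (+-comm 1 (7 * v))) (+-monoʳ-≤ (7 * v) (s≤s z≤n))) T≤t)) ⟩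
    t ^ 3 * v + t * (t * t)                               ≡⟨ cong (t ^ 3 * v +_) (cube t) ⟩
    t ^ 3 * v + t ^ 3                                     ∎
    where
    open ≤-Reasoning
    t = root p r
    instance
      t≢0 : NonZero t
      t≢0 = >-nonZero (<⇒≤ 2≤t)
    t≤t² : t ≤ t * t
    t≤t² = m≤m*n t t
    1≤t² : 1 ≤ t * t
    1≤t² = ≤-trans (<⇒≤ 2≤t) t≤t²
    cube : ∀ x → x * (x * x) ≡ x ^ 3
    cube x = cong (λ y → x * (x * y)) (sym (*-identityʳ x))
    expand-cube : ∀ t v → suc t * (suc t * suc t) * v ≡ t * (t * t) * v + v * (3 * (t * t) + 3 * t + 1)
    expand-cube = solve-∀
    expand : ∀ t v → suc t ^ 3 * v ≡ t ^ 3 * v + v * (3 * (t * t) + 3 * t + 1)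
    expand t v = ≡.trans (cong (_* v) (sym (cube (suc t))))
      (≡.trans (expand-cube t v) (cong (λ x → x * v + v * (3 * (t * t) + 3 * t + 1)) (cube t)))
    collect : ∀ t v → v * (3 * (t * t) + 3 * (t * t) + t * t) ≡ 7 * v * (t * t)
    collect = solve-∀

  kD≤kN : ∀ p r → kDen p r ≤ kNum p r
  kD≤kN p r with 2 ≤? root p r
  ... | yes _ = ^-monoˡ-≤ 3 (n≤1+n (root p r))
  ... | no  _ = s≤s z≤n

  -- A linear extension exists because n! ≥ 1 bounds a product with this factor from below.
  e-levels≢0 : ∀ H n → NonZero (e (levels H n))
  e-levels≢0 H n with e (levels H n) | ≤-trans (1≤n! n) (factorial≤e*e H n)
  ... | suc _ | _   = _
  ... | zero  | 1≤0 = contradiction (≤-trans 1≤0 (≤-reflexive (*-zeroʳ (e (chains H n))))) λ ()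

  module _ (u w r : ℕ) (u+w≡r : u + w ≡ r) (1≤u : 1 ≤ u) (1≤w : 1 ≤ w) where

    private
      u<r : u < r
      u<r = ≤-trans (m<m+n u 1≤w) (≤-reflexive u+w≡r)

      w<r : w < r
      w<r = ≤-trans (m<n+m w 1≤u) (≤-reflexive u+w≡r)

      w+u≡r : w + u ≡ r
      w+u≡r = ≡.trans (+-comm w u) u+w≡r

      complement : ∀ {x y c} → x + y ≡ c → u * c ≤ r * x → r * y ≤ w * c
      complement {x} {y} {c} x+y≡c uc≤rx = +-cancelˡ-≤ (u * c) _ _ (begin
        u * c + r * y      ≤⟨ +-monoˡ-≤ (r * y) uc≤rx ⟩
        r * x + r * y      ≡⟨ sym (*-distribˡ-+ r x y) ⟩
        r * (x + y)        ≡⟨ cong₂ _*_ (sym u+w≡r) x+y≡c ⟩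
        (u + w) * c        ≡⟨ *-distribʳ-+ c u w ⟩
        u * c + w * c      ∎)
        where open ≤-Reasoning

      complement⁻¹ : ∀ {x y c} → x + y ≡ c → r * y ≤ w * c → u * c ≤ r * x
      complement⁻¹ {x} {y} {c} x+y≡c ry≤wc = +-cancelʳ-≤ (w * c) _ _ (begin
        u * c + w * c      ≡⟨ sym (*-distribʳ-+ c u w) ⟩
        (u + w) * c        ≡⟨ cong₂ _*_ u+w≡r (sym x+y≡c) ⟩
        r * (x + y)        ≡⟨ *-distribˡ-+ r x y ⟩
        r * x + r * y      ≤⟨ +-monoʳ-≤ (r * x) ry≤wc ⟩
        r * x + w * c      ∎)
        where open ≤-Reasoning

    max-lower : ∀ n → kThreshold u r ≤ n →
      Σ (Poset n) λ Q → (u * choose2 n ≤ r * comp Q) × (kDen u r ^ n * n ! < kNum u r ^ n * e Q)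
    max-lower n N≤n with few-extensions w u r n w+u≡r 1≤w N≤n
    ... | few H comp-bounded e-bounded = levels H n , complement⁻¹ (comp-levels+comp-chains H n) comp-bounded , (begin-strict
      kDen u r ^ n * n !                                   ≤⟨ *-monoʳ-≤ (kDen u r ^ n) (factorial≤e*e H n) ⟩
      kDen u r ^ n * (e (chains H n) * e (levels H n))     ≡⟨ sym (*-assoc (kDen u r ^ n) (e (chains H n)) (e (levels H n))) ⟩
      kDen u r ^ n * e (chains H n) * e (levels H n)       <⟨ *-monoˡ-< (e (levels H n)) {{e-levels≢0 H n}} e-bounded ⟩
      kNum u r ^ n * e (levels H n)                        ∎)
      where open ≤-Reasoning

    max-upper : ∀ n → gT w r ≤ n → (Q : Poset n) → u * choose2 n ≤ r * comp Q →
      gD w r ^ n * e Q < gN w r ^ n * n !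
    max-upper n N≤n Q many = e-upper w r (root w r) n Q (g-gap-root w r 1≤w w<r) N≤n (complement (comp+inc Q) many)

    min-lower : ∀ n → gT u r ≤ n → (Q : Poset n) → r * comp Q ≤ u * choose2 n →
      gD u r ^ n < gN u r ^ n * e Q
    min-lower n N≤n Q sparse = e-lower u r (root u r) n Q (g-gap-root u r 1≤u u<r) N≤n sparse

    min-upper : ∀ n → kThreshold w r ≤ n →
      Σ (Poset n) λ Q → (r * comp Q ≤ u * choose2 n) × (kDen w r ^ n * e Q < kNum w r ^ n)
    min-upper n N≤n with few-extensions u w r n u+w≡r 1≤u N≤n
    ... | few H comp-bounded e-bounded = chains H n , comp-bounded , e-bounded

    -- The two formulas are not compared directly. At a size N beyond both thresholds the example
    -- `Q` satisfies both bounds, so c₁^N N! < e Q < c₂^N N!, and c₁ < c₂ follows.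
    max-consistent : kDen u r * gD w r < gN w r * kNum u r
    max-consistent = combine (max-lower N (m≤m⊔n _ _))
      where
      open ≤-Reasoning
      N = kThreshold u r ⊔ gT w r
      swap : ∀ a b c → a * b * c ≡ b * (a * c)
      swap = solve-∀
      swap′ : ∀ a b c → a * (b * c) ≡ b * a * c
      swap′ = solve-∀

      combine : (Σ (Poset N) λ Q → (u * choose2 N ≤ r * comp Q) × (kDen u r ^ N * N ! < kNum u r ^ N * e Q)) →
                kDen u r * gD w r < gN w r * kNum u r
      combine (Q , many , lower) = ^-cancelˡ-< N _ _ (*-cancelʳ-< (N !) _ _ (begin-strict
        (kDen u r * gD w r) ^ N * N !              ≡⟨ cong (_* N !) (^-distribʳ-* N (kDen u r) (gD w r)) ⟩
        kDen u r ^ N * gD w r ^ N * N !            ≡⟨ swap (kDen u r ^ N) (gD w r ^ N) (N !) ⟩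
        gD w r ^ N * (kDen u r ^ N * N !)          ≤⟨ *-monoʳ-≤ (gD w r ^ N) (<⇒≤ lower) ⟩
        gD w r ^ N * (kNum u r ^ N * e Q)          ≡⟨ *-left-comm (gD w r ^ N) (kNum u r ^ N) (e Q) ⟩
        kNum u r ^ N * (gD w r ^ N * e Q)          <⟨ *-monoʳ-< (kNum u r ^ N) {{m^n≢0 (kNum u r) N {{>-nonZero (1≤kN u r)}}}} (max-upper N (m≤n⊔m _ _) Q many) ⟩
        kNum u r ^ N * (gN w r ^ N * N !)          ≡⟨ swap′ (kNum u r ^ N) (gN w r ^ N) (N !) ⟩
        gN w r ^ N * kNum u r ^ N * N !            ≡⟨ cong (_* N !) (sym (^-distribʳ-* N (gN w r) (kNum u r))) ⟩
        (gN w r * kNum u r) ^ N * N !              ∎))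

    min-consistent : gD u r * kDen w r < kNum w r * gN u r
    min-consistent = combine (min-upper N (m≤m⊔n _ _))
      where
      open ≤-Reasoning
      N = kThreshold w r ⊔ gT u r
      rotate : ∀ a b c → a * b * c ≡ a * (c * b)
      rotate = solve-∀

      combine : (Σ (Poset N) λ Q → (r * comp Q ≤ u * choose2 N) × (kDen w r ^ N * e Q < kNum w r ^ N)) →
                gD u r * kDen w r < kNum w r * gN u r
      combine (Q , sparse , upper) = ^-cancelˡ-< N _ _ (begin-strict
        (gD u r * kDen w r) ^ N                    ≡⟨ ^-distribʳ-* N (gD u r) (kDen w r) ⟩
        gD u r ^ N * kDen w r ^ N                  ≤⟨ *-monoˡ-≤ (kDen w r ^ N) (<⇒≤ (min-lower N (m≤n⊔m _ _) Q sparse)) ⟩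
        gN u r ^ N * e Q * kDen w r ^ N            ≡⟨ rotate (gN u r ^ N) (e Q) (kDen w r ^ N) ⟩
        gN u r ^ N * (kDen w r ^ N * e Q)          <⟨ *-monoʳ-< (gN u r ^ N) {{m^n≢0 (gN u r) N {{>-nonZero (1≤gN u r 1≤u u<r)}}}} upper ⟩
        gN u r ^ N * kNum w r ^ N                  ≡⟨ *-comm (gN u r ^ N) _ ⟩
        kNum w r ^ N * gN u r ^ N                  ≡⟨ sym (^-distribʳ-* N (kNum w r) (gN u r)) ⟩
        (kNum w r * gN u r) ^ N                    ∎)

-- Rational numbers as fractions of natural numbers

open Counting using (root; root-greatest; kNum; kDen; kThreshold; kN-small; kD≤kN; 1≤kN; 1≤kD; gN; gD; gT; gN<gD; gN*v<gD; 1≤gN; max-lower; max-upper; max-consistent; min-lower; min-upper; min-consistent)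
import Data.Integer.Base as ℤ
import Data.Integer.Properties as ℤ
import Data.Nat.Base as ℕ
import Data.Nat.Properties as ℕ
import Data.Rational.Unnormalised.Base as ℚᵘ
import Data.Rational.Unnormalised.Properties as ℚᵘ
open import Data.Integer.Base using (+_; -[1+_]; ∣_∣)
open import Data.Nat.Base using (ℕ; zero; suc; _≥_; _!)
open import Data.Nat.Tactic.RingSolver using (solve-∀)
open import Data.Product using (Σ; _×_; ∃; ∃-syntax; _,_; proj₁; proj₂; map; map₂)
open import Data.Rational.Base using (ℚ; 0ℚ; 1ℚ; _<_; _≤_; _*_; _+_; _-_; -_; mkℚ; ↥_; ↧ₙ_; toℚᵘ; _/_; *<*)
open import Data.Rational.Properties using (toℚᵘ-fromℚᵘ; toℚᵘ-homo-*; toℚᵘ-homo-+; toℚᵘ-cancel-<; toℚᵘ-cancel-≤; toℚᵘ-mono-<; toℚᵘ-mono-≤; <-trans; negative⁻¹; +-monoˡ-<; +-assoc; +-inverseʳ; +-inverseˡ; +-identityʳ)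
open import Relation.Binary.PropositionalEquality as ≡ using (_≡_; refl; sym; cong; cong₂; subst; subst₂)

-- Frac q a b: the rational q equals a / b, with b nonzero but not necessarily in lowest terms.
data Frac (q : ℚ) (a : ℕ) : ℕ → Set where
  frac : ∀ {b} → toℚᵘ q ℚᵘ.≃ ℚᵘ.mkℚᵘ (+ a) b → Frac q a (suc b)

-- The default value at denominator zero keeps the constants total functions on ℚ: for δ > 1, for
-- instance, `root` and with it `gN` vanish in the denominator of c₃.
_÷_ : ℕ → ℕ → ℚ
a ÷ zero  = 0ℚ
a ÷ suc b = + a / suc b

÷-Frac : ∀ a {b} → 1 ℕ.≤ b → Frac (a ÷ b) a b
÷-Frac a {suc b} _ = frac (toℚᵘ-fromℚᵘ (ℚᵘ.mkℚᵘ (+ a) b))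

ℕtoℚ-Frac : ∀ m → Frac (ℕtoℚ m) m 1
ℕtoℚ-Frac m = ÷-Frac m (ℕ.s≤s ℕ.z≤n)

0ℚ-Frac : Frac 0ℚ 0 1
0ℚ-Frac = frac ℚᵘ.≃-refl

1ℚ-Frac : Frac 1ℚ 1 1
1ℚ-Frac = frac ℚᵘ.≃-refl

*-Frac : ∀ {q q′ a b c d} → Frac q a b → Frac q′ c d → Frac (q * q′) (a ℕ.* c) (b ℕ.* d)
*-Frac {q} {q′} {a} {_} {c} (frac {b} q≃) (frac {d} q′≃) = frac (ℚᵘ.≃-trans (toℚᵘ-homo-* q q′)
  (ℚᵘ.≃-trans (ℚᵘ.*-cong q≃ q′≃)
    (ℚᵘ.≃-reflexive (cong (λ x → ℚᵘ.mkℚᵘ x (d ℕ.+ b ℕ.* suc d)) (sym (ℤ.pos-* a c))))))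

+-Frac : ∀ {q q′ a b c d} → Frac q a b → Frac q′ c d → Frac (q + q′) (a ℕ.* d ℕ.+ c ℕ.* b) (b ℕ.* d)
+-Frac {q} {q′} {a} {_} {c} (frac {b} q≃) (frac {d} q′≃) = frac (ℚᵘ.≃-trans (toℚᵘ-homo-+ q q′)
  (ℚᵘ.≃-trans (ℚᵘ.+-cong q≃ q′≃)
    (ℚᵘ.≃-reflexive (cong (λ x → ℚᵘ.mkℚᵘ x (d ℕ.+ b ℕ.* suc d))
      (sym (≡.trans (ℤ.pos-+ (a ℕ.* suc d) (c ℕ.* suc b)) (cong₂ ℤ._+_ (ℤ.pos-* a (suc d)) (ℤ.pos-* c (suc b)))))))))

^-Frac : ∀ {q a b} n → Frac q a b → Frac (q ^ℚ n) (a ℕ.^ n) (b ℕ.^ n)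
^-Frac zero    fq = 1ℚ-Frac
^-Frac (suc n) fq = *-Frac fq (^-Frac n fq)

<-Frac : ∀ {q q′ a b c d} → Frac q a b → Frac q′ c d → a ℕ.* d ℕ.< c ℕ.* b → q < q′
<-Frac {a = a} {c = c} (frac {b} q≃) (frac {d} q′≃) ad<cb = toℚᵘ-cancel-<
  (ℚᵘ.<-respˡ-≃ (ℚᵘ.≃-sym q≃) (ℚᵘ.<-respʳ-≃ (ℚᵘ.≃-sym q′≃)
    (ℚᵘ.*<* (subst₂ ℤ._<_ (ℤ.pos-* a (suc d)) (ℤ.pos-* c (suc b)) (ℤ.+<+ ad<cb)))))

<-Frac⁻ : ∀ {q q′ a b c d} → Frac q a b → Frac q′ c d → q < q′ → a ℕ.* d ℕ.< c ℕ.* b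
<-Frac⁻ {a = a} {c = c} (frac {b} q≃) (frac {d} q′≃) q<q′
  with ℚᵘ.<-respˡ-≃ q≃ (ℚᵘ.<-respʳ-≃ q′≃ (toℚᵘ-mono-< q<q′))
... | ℚᵘ.*<* ad<cb = ℤ.drop‿+<+ (subst₂ ℤ._<_ (sym (ℤ.pos-* a (suc d))) (sym (ℤ.pos-* c (suc b))) ad<cb)

≤-Frac : ∀ {q q′ a b c d} → Frac q a b → Frac q′ c d → a ℕ.* d ℕ.≤ c ℕ.* b → q ≤ q′
≤-Frac {a = a} {c = c} (frac {b} q≃) (frac {d} q′≃) ad≤cb = toℚᵘ-cancel-≤
  (ℚᵘ.≤-respˡ-≃ (ℚᵘ.≃-sym q≃) (ℚᵘ.≤-respʳ-≃ (ℚᵘ.≃-sym q′≃)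
    (ℚᵘ.*≤* (subst₂ ℤ._≤_ (ℤ.pos-* a (suc d)) (ℤ.pos-* c (suc b)) (ℤ.+≤+ ad≤cb)))))

≤-Frac⁻ : ∀ {q q′ a b c d} → Frac q a b → Frac q′ c d → q ≤ q′ → a ℕ.* d ℕ.≤ c ℕ.* b
≤-Frac⁻ {a = a} {c = c} (frac {b} q≃) (frac {d} q′≃) q≤q′
  with ℚᵘ.≤-respˡ-≃ q≃ (ℚᵘ.≤-respʳ-≃ q′≃ (toℚᵘ-mono-≤ q≤q′))
... | ℚᵘ.*≤* ad≤cb = ℤ.drop‿+≤+ (subst₂ ℤ._≤_ (sym (ℤ.pos-* a (suc d))) (sym (ℤ.pos-* c (suc b))) ad≤cb)

num den : ℚ → ℕ
num q = ∣ ↥ q ∣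
den q = ↧ₙ q

positive-Frac : ∀ q → 0ℚ < q → Frac q (num q) (den q) × 1 ℕ.≤ num q
positive-Frac (mkℚ (+ zero)   b c) (*<* (ℤ.+<+ ()))
positive-Frac (mkℚ (+ suc a)  b c) _ = frac ℚᵘ.≃-refl , ℕ.s≤s ℕ.z≤n
positive-Frac (mkℚ -[1+ a ]   b c) (*<* ())

x-y<z : ∀ {x y z} → x < z + y → x - y < z
x-y<z {x} {y} {z} x<z+y = subst (x - y <_)
  (≡.trans (+-assoc z y (- y)) (≡.trans (cong (_+_ z) (+-inverseʳ y)) (+-identityʳ z)))
  (+-monoˡ-< (- y) x<z+y)

x<z+y : ∀ {x y z} → x - y < z → x < z + y
x<z+y {x} {y} {z} x-y<z = subst (_< z + y)
  (≡.trans (+-assoc x (- y) y) (≡.trans (cong (_+_ x) (+-inverseˡ y)) (+-identityʳ x)))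
  (+-monoˡ-< y x-y<z)

-- A density δ = u / r and its complement w / r

conum : ℚ → ℕ
conum δ = den δ ℕ.∸ num δ

module Density δ (0<δ : 0ℚ < δ) (δ<1 : δ < 1ℚ) where

  u = num δ
  w = conum δ
  r = den δ

  δ-Frac : Frac δ u r
  δ-Frac = proj₁ (positive-Frac δ 0<δ)

  1≤u : 1 ℕ.≤ u
  1≤u = proj₂ (positive-Frac δ 0<δ)

  u<r : u ℕ.< r
  u<r = subst₂ ℕ._<_ (ℕ.*-identityʳ u) (ℕ.+-identityʳ r) (<-Frac⁻ δ-Frac 1ℚ-Frac δ<1)

  1≤w : 1 ℕ.≤ w
  1≤w = ℕ.m<n⇒0<n∸m u<r

  u+w≡r : u ℕ.+ w ≡ r
  u+w≡r = ℕ.m+[n∸m]≡n (ℕ.<⇒≤ u<r)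

  w<r : w ℕ.< r
  w<r = ℕ.≤-trans (ℕ.m<n+m w 1≤u) (ℕ.≤-reflexive u+w≡r)

  1≤gD : ∀ p → 1 ℕ.≤ p → p ℕ.< r → 1 ℕ.≤ gD p r
  1≤gD p 1≤p p<r = ℕ.≤-trans (ℕ.s≤s ℕ.z≤n) (gN<gD p r 1≤p p<r)

  δ*-Frac : ∀ c → Frac (δ * ℕtoℚ c) (u ℕ.* c) (r ℕ.* 1)
  δ*-Frac c = *-Frac δ-Frac (ℕtoℚ-Frac c)

  many⁻ : ∀ {c x} → δ * ℕtoℚ c ≤ ℕtoℚ x → u ℕ.* c ℕ.≤ r ℕ.* x
  many⁻ {c} {x} le = subst₂ ℕ._≤_ (ℕ.*-identityʳ (u ℕ.* c))
    (≡.trans (cong (x ℕ.*_) (ℕ.*-identityʳ r)) (ℕ.*-comm x r)) (≤-Frac⁻ (δ*-Frac c) (ℕtoℚ-Frac x) le)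

  many⁺ : ∀ {c x} → u ℕ.* c ℕ.≤ r ℕ.* x → δ * ℕtoℚ c ≤ ℕtoℚ x
  many⁺ {c} {x} le = ≤-Frac (δ*-Frac c) (ℕtoℚ-Frac x) (subst₂ ℕ._≤_ (sym (ℕ.*-identityʳ (u ℕ.* c)))
    (sym (≡.trans (cong (x ℕ.*_) (ℕ.*-identityʳ r)) (ℕ.*-comm x r))) le)

  few⁻ : ∀ {c x} → ℕtoℚ x ≤ δ * ℕtoℚ c → r ℕ.* x ℕ.≤ u ℕ.* c
  few⁻ {c} {x} le = subst₂ ℕ._≤_ (≡.trans (cong (x ℕ.*_) (ℕ.*-identityʳ r)) (ℕ.*-comm x r))
    (ℕ.*-identityʳ (u ℕ.* c)) (≤-Frac⁻ (ℕtoℚ-Frac x) (δ*-Frac c) le)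

  few⁺ : ∀ {c x} → r ℕ.* x ℕ.≤ u ℕ.* c → ℕtoℚ x ≤ δ * ℕtoℚ c
  few⁺ {c} {x} le = ≤-Frac (ℕtoℚ-Frac x) (δ*-Frac c) (subst₂ ℕ._≤_
    (sym (≡.trans (cong (x ℕ.*_) (ℕ.*-identityʳ r)) (ℕ.*-comm x r))) (sym (ℕ.*-identityʳ (u ℕ.* c))) le)

^*<ℕ : ∀ {q a b} n x y → Frac q a b → a ℕ.^ n ℕ.* x ℕ.< b ℕ.^ n ℕ.* y → (q ^ℚ n) * ℕtoℚ x < ℕtoℚ y
^*<ℕ {b = b} n x y fq lt = <-Frac (*-Frac (^-Frac n fq) (ℕtoℚ-Frac x)) (ℕtoℚ-Frac y)
  (subst₂ ℕ._<_ (sym (ℕ.*-identityʳ _)) (≡.trans (ℕ.*-comm (b ℕ.^ n) y) (cong (y ℕ.*_) (sym (ℕ.*-identityʳ _)))) lt)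

ℕ<^* : ∀ {q a b} n x y → Frac q a b → b ℕ.^ n ℕ.* y ℕ.< a ℕ.^ n ℕ.* x → ℕtoℚ y < (q ^ℚ n) * ℕtoℚ x
ℕ<^* {b = b} n x y fq lt = <-Frac (ℕtoℚ-Frac y) (*-Frac (^-Frac n fq) (ℕtoℚ-Frac x))
  (subst₂ ℕ._<_ (≡.trans (ℕ.*-comm (b ℕ.^ n) y) (cong (y ℕ.*_) (sym (ℕ.*-identityʳ _)))) (sym (ℕ.*-identityʳ _)) lt)

^<ℕ : ∀ {q a b} n y → Frac q a b → a ℕ.^ n ℕ.< b ℕ.^ n ℕ.* y → q ^ℚ n < ℕtoℚ y
^<ℕ {b = b} n y fq lt = <-Frac (^-Frac n fq) (ℕtoℚ-Frac y)
  (subst₂ ℕ._<_ (sym (ℕ.*-identityʳ _)) (ℕ.*-comm (b ℕ.^ n) y) lt)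

ℕ<^ : ∀ {q a b} n y → Frac q a b → b ℕ.^ n ℕ.* y ℕ.< a ℕ.^ n → ℕtoℚ y < q ^ℚ n
ℕ<^ {b = b} n y fq lt = <-Frac (ℕtoℚ-Frac y) (^-Frac n fq)
  (subst₂ ℕ._<_ (ℕ.*-comm (b ℕ.^ n) y) (sym (ℕ.*-identityʳ _)) lt)

-- The four constants and their bounds at a fixed density

c₁ c₂ c₃ c₄ : ℚ → ℚ
c₁ δ = kDen (num δ) (den δ) ÷ kNum (num δ) (den δ)
c₂ δ = gN (conum δ) (den δ) ÷ gD (conum δ) (den δ)
c₃ δ = gD (num δ) (den δ) ÷ gN (num δ) (den δ)
c₄ δ = kNum (conum δ) (den δ) ÷ kDen (conum δ) (den δ)

module Bounds δ (0<δ : 0ℚ < δ) (δ<1 : δ < 1ℚ) where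

  open Density δ 0<δ δ<1 public

  c₁-Frac : Frac (c₁ δ) (kDen u r) (kNum u r)
  c₁-Frac = ÷-Frac _ (1≤kN u r)

  c₂-Frac : Frac (c₂ δ) (gN w r) (gD w r)
  c₂-Frac = ÷-Frac _ (1≤gD w 1≤w w<r)

  c₃-Frac : Frac (c₃ δ) (gD u r) (gN u r)
  c₃-Frac = ÷-Frac _ (1≤gN u r 1≤u u<r)

  c₄-Frac : Frac (c₄ δ) (kNum w r) (kDen w r)
  c₄-Frac = ÷-Frac _ (1≤kD w r)

  0<c₁ : 0ℚ < c₁ δ
  0<c₁ = <-Frac 0ℚ-Frac c₁-Frac (ℕ.≤-trans (1≤kD u r) (ℕ.≤-reflexive (sym (ℕ.*-identityʳ _))))

  c₁<c₂ : c₁ δ < c₂ δ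
  c₁<c₂ = <-Frac c₁-Frac c₂-Frac (max-consistent u w r u+w≡r 1≤u 1≤w)

  c₂<1 : c₂ δ < 1ℚ
  c₂<1 = <-Frac c₂-Frac 1ℚ-Frac (subst₂ ℕ._<_ (sym (ℕ.*-identityʳ _)) (sym (ℕ.+-identityʳ _)) (gN<gD w r 1≤w w<r))

  1<c₃ : 1ℚ < c₃ δ
  1<c₃ = <-Frac 1ℚ-Frac c₃-Frac (subst₂ ℕ._<_ (sym (ℕ.+-identityʳ _)) (sym (ℕ.*-identityʳ _)) (gN<gD u r 1≤u u<r))

  c₃<c₄ : c₃ δ < c₄ δ
  c₃<c₄ = <-Frac c₃-Frac c₄-Frac (min-consistent u w r u+w≡r 1≤u 1≤w)

  N⁺ N⁻ : ℕ
  N⁺ = kThreshold u r ℕ.⊔ gT w r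
  N⁻ = gT u r ℕ.⊔ kThreshold w r

  f⁺-lower : ∀ n → n ≥ N⁺ → Σ (Poset n) λ Q → (δ * ℕtoℚ (choose2 n) ≤ ℕtoℚ (comp Q))
             × ((c₁ δ ^ℚ n) * ℕtoℚ (n !) < ℕtoℚ (e Q))
  f⁺-lower n n≥N = map₂ (λ {Q} → map many⁺ (^*<ℕ n (n !) (e Q) c₁-Frac))
    (max-lower u w r u+w≡r 1≤u 1≤w n (ℕ.≤-trans (ℕ.m≤m⊔n (kThreshold u r) (gT w r)) n≥N))

  f⁺-upper : ∀ n → n ≥ N⁺ → ∀ (Q : Poset n) → δ * ℕtoℚ (choose2 n) ≤ ℕtoℚ (comp Q) →
             ℕtoℚ (e Q) < (c₂ δ ^ℚ n) * ℕtoℚ (n !)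
  f⁺-upper n n≥N Q many = ℕ<^* n (n !) (e Q) c₂-Frac
    (max-upper u w r u+w≡r 1≤u 1≤w n (ℕ.≤-trans (ℕ.m≤n⊔m (kThreshold u r) (gT w r)) n≥N) Q (many⁻ many))

  f⁻-lower : ∀ n → n ≥ N⁻ → ∀ (Q : Poset n) → ℕtoℚ (comp Q) ≤ δ * ℕtoℚ (choose2 n) →
             c₃ δ ^ℚ n < ℕtoℚ (e Q)
  f⁻-lower n n≥N Q sparse = ^<ℕ n (e Q) c₃-Frac
    (min-lower u w r u+w≡r 1≤u 1≤w n (ℕ.≤-trans (ℕ.m≤m⊔n (gT u r) (kThreshold w r)) n≥N) Q (few⁻ sparse))

  f⁻-upper : ∀ n → n ≥ N⁻ → Σ (Poset n) λ Q → (ℕtoℚ (comp Q) ≤ δ * ℕtoℚ (choose2 n))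
             × (ℕtoℚ (e Q) < c₄ δ ^ℚ n)
  f⁻-upper n n≥N = map₂ (λ {Q} → map few⁺ (ℕ<^ n (e Q) c₄-Frac))
    (min-upper u w r u+w≡r 1≤u 1≤w n (ℕ.≤-trans (ℕ.m≤n⊔m (gT u r) (kThreshold w r)) n≥N))

-- Behaviour of the constants as δ tends to 0 or 1

module Limits (T : ℕ) (1≤T : 1 ℕ.≤ T) where

  1≤T² : 1 ℕ.≤ T ℕ.* T
  1≤T² = ℕ.*-mono-≤ 1≤T 1≤T

  -- For δ = u / r, the inequality δ < 1 / T² reads T² u < r, which puts T among the candidates for
  -- `root u r`; near 1 the same applies to w / r = 1 - δ.
  η : ℚ
  η = 1 ÷ (T ℕ.* T)

  η-Frac : Frac η 1 (T ℕ.* T)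
  η-Frac = ÷-Frac 1 1≤T²

  0<η : 0ℚ < η
  0<η = <-Frac 0ℚ-Frac η-Frac (ℕ.s≤s ℕ.z≤n)

  module _ δ (0<δ : 0ℚ < δ) (δ<1 : δ < 1ℚ) where

    open Density δ 0<δ δ<1

    δ→0 : δ < η → T ℕ.≤ root u r
    δ→0 δ<η = root-greatest u r T 1≤u (ℕ.<⇒≤ (subst₂ ℕ._<_ (ℕ.*-comm u (T ℕ.* T)) (ℕ.+-identityʳ r)
      (<-Frac⁻ δ-Frac η-Frac δ<η)))

    δ→1 : 1ℚ - η < δ → T ℕ.≤ root w r
    δ→1 1-η<δ = root-greatest w r T 1≤w (ℕ.+-cancelˡ-≤ (u ℕ.* (T ℕ.* T)) _ _ (begin
      u ℕ.* (T ℕ.* T) ℕ.+ T ℕ.* T ℕ.* w           ≡⟨ collect u w (T ℕ.* T) ⟩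
      1 ℕ.* ((u ℕ.+ w) ℕ.* (T ℕ.* T))             ≡⟨ cong (λ x → 1 ℕ.* (x ℕ.* (T ℕ.* T))) u+w≡r ⟩
      1 ℕ.* (r ℕ.* (T ℕ.* T))                     ≤⟨ ℕ.<⇒≤ (<-Frac⁻ 1ℚ-Frac (+-Frac δ-Frac η-Frac) (x<z+y 1-η<δ)) ⟩
      (u ℕ.* (T ℕ.* T) ℕ.+ 1 ℕ.* r) ℕ.* 1         ≡⟨ simplify (u ℕ.* (T ℕ.* T)) r ⟩
      u ℕ.* (T ℕ.* T) ℕ.+ r                       ∎))
      where
      open ℕ.≤-Reasoning
      collect : ∀ u w t → u ℕ.* t ℕ.+ t ℕ.* w ≡ 1 ℕ.* ((u ℕ.+ w) ℕ.* t)
      collect = solve-∀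
      simplify : ∀ a r → (a ℕ.+ 1 ℕ.* r) ℕ.* 1 ≡ a ℕ.+ r
      simplify = solve-∀

-- T = 7 v + 2 serves all four limits: it is the bound asked for by `kN-small`, and it exceeds the 2
-- v asked for by `gN*v<gD`.
1≤7v+2 : ∀ v → 1 ℕ.≤ 7 ℕ.* v ℕ.+ 2
1≤7v+2 v = ℕ.≤-trans (ℕ.s≤s ℕ.z≤n) (ℕ.m≤n+m 2 (7 ℕ.* v))

2v≤7v+2 : ∀ v → 2 ℕ.* v ℕ.≤ 7 ℕ.* v ℕ.+ 2
2v≤7v+2 v = ℕ.≤-trans (ℕ.*-monoˡ-≤ v {2} {7} (ℕ.s≤s (ℕ.s≤s ℕ.z≤n))) (ℕ.m≤m+n (7 ℕ.* v) 2)

-- With v the denominator of ε one has ε ≥ 1/v. As kD ≤ kN, the distance 1 - c₁ = (kN - kD) / kN is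
-- at most kN / kD - 1, which `kN-small` puts below 1/v.
c₁→1 : ∀ (ε : ℚ) → 0ℚ < ε → Σ ℚ λ η → (0ℚ < η) ×
       (∀ (δ : ℚ) → 0ℚ < δ → δ < η → δ < 1ℚ → 1ℚ - ε < c₁ δ)
c₁→1 ε 0<ε with positive-Frac ε 0<ε
... | ε-Frac , 1≤x = η , 0<η , λ δ 0<δ δ<η δ<1 → close δ 0<δ δ<1 (δ→0 δ 0<δ δ<1 δ<η)
  where
  x = num ε
  v = den ε
  open Limits (7 ℕ.* v ℕ.+ 2) (1≤7v+2 v)

  close : ∀ δ → 0ℚ < δ → δ < 1ℚ → 7 ℕ.* v ℕ.+ 2 ℕ.≤ root (num δ) (den δ) → 1ℚ - ε < c₁ δ
  close δ 0<δ δ<1 T≤t = x-y<z (<-Frac 1ℚ-Frac (+-Frac c₁-Frac ε-Frac) (begin-strict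
    1 ℕ.* (kN ℕ.* v)                              ≡⟨ ℕ.+-identityʳ _ ⟩
    kN ℕ.* v                                      <⟨ kN-small u r v T≤t ⟩
    kD ℕ.* v ℕ.+ kD                               ≤⟨ ℕ.+-monoʳ-≤ (kD ℕ.* v) (kD≤kN u r) ⟩
    kD ℕ.* v ℕ.+ kN                               ≡⟨ cong (kD ℕ.* v ℕ.+_) (sym (ℕ.+-identityʳ kN)) ⟩
    kD ℕ.* v ℕ.+ 1 ℕ.* kN                         ≤⟨ ℕ.+-monoʳ-≤ (kD ℕ.* v) (ℕ.*-monoˡ-≤ kN 1≤x) ⟩
    kD ℕ.* v ℕ.+ x ℕ.* kN                         ≡⟨ sym (ℕ.*-identityʳ _) ⟩
    (kD ℕ.* v ℕ.+ x ℕ.* kN) ℕ.* 1                 ∎))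
    where
    open Bounds δ 0<δ δ<1
    open ℕ.≤-Reasoning
    kN = kNum u r
    kD = kDen u r

c₂→0 : ∀ (ε : ℚ) → 0ℚ < ε → Σ ℚ λ η → (0ℚ < η) ×
       (∀ (δ : ℚ) → 0ℚ < δ → 1ℚ - η < δ → δ < 1ℚ → c₂ δ < ε)
c₂→0 ε 0<ε with positive-Frac ε 0<ε
... | ε-Frac , 1≤x = η , 0<η , λ δ 0<δ 1-η<δ δ<1 → close δ 0<δ δ<1 (δ→1 δ 0<δ δ<1 1-η<δ)
  where
  x = num ε
  v = den ε
  open Limits (7 ℕ.* v ℕ.+ 2) (1≤7v+2 v)

  close : ∀ δ → 0ℚ < δ → δ < 1ℚ → 7 ℕ.* v ℕ.+ 2 ℕ.≤ root (conum δ) (den δ) → c₂ δ < ε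
  close δ 0<δ δ<1 T≤t = <-Frac c₂-Frac ε-Frac
    (ℕ.≤-trans (gN*v<gD w r 1≤w w<r v (ℕ.≤-trans (2v≤7v+2 v) T≤t))
      (ℕ.≤-trans (ℕ.≤-reflexive (sym (ℕ.+-identityʳ _))) (ℕ.*-monoˡ-≤ (gD w r) 1≤x)))
    where open Bounds δ 0<δ δ<1

-- A nonnegative M is at most its numerator, and `gN*v<gD` with that numerator for v puts c₃ above
-- it. A negative M lies below 1 < c₃.
c₃→∞ : ∀ (M : ℚ) → Σ ℚ λ η → (0ℚ < η) ×
       (∀ (δ : ℚ) → 0ℚ < δ → δ < η → δ < 1ℚ → M < c₃ δ)
c₃→∞ M = η , 0<η , λ δ 0<δ δ<η δ<1 → large M δ 0<δ δ<1 (δ→0 δ 0<δ δ<1 δ<η)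
  where
  open Limits (7 ℕ.* num M ℕ.+ 2) (1≤7v+2 (num M))

  large : ∀ M δ → 0ℚ < δ → δ < 1ℚ → 7 ℕ.* num M ℕ.+ 2 ℕ.≤ root (num δ) (den δ) → M < c₃ δ
  large M@(mkℚ -[1+ _ ] _ _) δ 0<δ δ<1 T≤t = <-trans (negative⁻¹ M) (<-trans 0<1 1<c₃)
    where
    open Bounds δ 0<δ δ<1
    0<1 : 0ℚ < 1ℚ
    0<1 = <-Frac 0ℚ-Frac 1ℚ-Frac (ℕ.s≤s ℕ.z≤n)
  large M@(mkℚ (+ m) d _) δ 0<δ δ<1 T≤t = <-Frac {q = M} (frac ℚᵘ.≃-refl) c₃-Frac (begin-strict
    m ℕ.* gN u r          ≡⟨ ℕ.*-comm m _ ⟩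
    gN u r ℕ.* m          <⟨ gN*v<gD u r 1≤u u<r m (ℕ.≤-trans (2v≤7v+2 m) T≤t) ⟩
    gD u r                ≤⟨ ℕ.m≤m*n (gD u r) (suc d) ⟩
    gD u r ℕ.* suc d      ∎)
    where
    open Bounds δ 0<δ δ<1
    open ℕ.≤-Reasoning

c₄→1 : ∀ (ε : ℚ) → 0ℚ < ε → Σ ℚ λ η → (0ℚ < η) ×
       (∀ (δ : ℚ) → 0ℚ < δ → 1ℚ - η < δ → δ < 1ℚ → c₄ δ < 1ℚ + ε)
c₄→1 ε 0<ε with positive-Frac ε 0<ε
... | ε-Frac , 1≤x = η , 0<η , λ δ 0<δ 1-η<δ δ<1 → close δ 0<δ δ<1 (δ→1 δ 0<δ δ<1 1-η<δ)
  where
  x = num ε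
  v = den ε
  open Limits (7 ℕ.* v ℕ.+ 2) (1≤7v+2 v)

  close : ∀ δ → 0ℚ < δ → δ < 1ℚ → 7 ℕ.* v ℕ.+ 2 ℕ.≤ root (conum δ) (den δ) → c₄ δ < 1ℚ + ε
  close δ 0<δ δ<1 T≤t = <-Frac c₄-Frac (+-Frac 1ℚ-Frac ε-Frac) (begin-strict
    kN ℕ.* (1 ℕ.* v)                              ≡⟨ cong (kN ℕ.*_) (ℕ.+-identityʳ v) ⟩
    kN ℕ.* v                                      <⟨ kN-small w r v T≤t ⟩
    kD ℕ.* v ℕ.+ kD                               ≡⟨ collect kD v ⟩
    (1 ℕ.* v ℕ.+ 1 ℕ.* 1) ℕ.* kD                  ≤⟨ ℕ.*-monoˡ-≤ kD (ℕ.+-monoʳ-≤ (1 ℕ.* v) (ℕ.*-monoˡ-≤ 1 1≤x)) ⟩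
    (1 ℕ.* v ℕ.+ x ℕ.* 1) ℕ.* kD                  ∎)
    where
    open Bounds δ 0<δ δ<1
    open ℕ.≤-Reasoning
    kN = kNum w r
    kD = kDen w r
    collect : ∀ k v → k ℕ.* v ℕ.+ k ≡ (1 ℕ.* v ℕ.+ 1 ℕ.* 1) ℕ.* k
    collect = solve-∀

theorem1p1 :
  -- (a) maximum f⁺(n,δ)
  (Σ (ℚ → ℚ) λ c₁ → Σ (ℚ → ℚ) λ c₂ →
    (∀ (δ : ℚ) → 0ℚ < δ → δ < 1ℚ →
      (0ℚ < c₁ δ) × (c₁ δ < c₂ δ) × (c₂ δ < 1ℚ) ×
      (∃[ N ] ∀ (n : ℕ) → n ≥ N →
        -- c₁(δ) < (f⁺(n,δ)/n!)^(1/n)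
        (Σ (Poset n) λ Q → (δ * ℕtoℚ (choose2 n) ≤ ℕtoℚ (comp Q))
            × ((c₁ δ ^ℚ n) * ℕtoℚ (n !) < ℕtoℚ (e Q)))
        -- (f⁺(n,δ)/n!)^(1/n) < c₂(δ)
        × (∀ (Q : Poset n) → δ * ℕtoℚ (choose2 n) ≤ ℕtoℚ (comp Q) →
            ℕtoℚ (e Q) < (c₂ δ ^ℚ n) * ℕtoℚ (n !))))
    -- c₁(δ) → 1 as δ → 0
    × (∀ (ε : ℚ) → 0ℚ < ε → Σ ℚ λ η → (0ℚ < η) ×
        (∀ (δ : ℚ) → 0ℚ < δ → δ < η → δ < 1ℚ → 1ℚ - ε < c₁ δ))
    -- c₂(δ) → 0 as δ → 1
    × (∀ (ε : ℚ) → 0ℚ < ε → Σ ℚ λ η → (0ℚ < η) ×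
        (∀ (δ : ℚ) → 0ℚ < δ → 1ℚ - η < δ → δ < 1ℚ → c₂ δ < ε)))
  ×
  -- (b) minimum f⁻(n,δ)
  (Σ (ℚ → ℚ) λ c₃ → Σ (ℚ → ℚ) λ c₄ →
    (∀ (δ : ℚ) → 0ℚ < δ → δ < 1ℚ →
      (1ℚ < c₃ δ) × (c₃ δ < c₄ δ) ×
      (∃[ N ] ∀ (n : ℕ) → n ≥ N →
        -- c₃(δ) < f⁻(n,δ)^(1/n)
        (∀ (Q : Poset n) → ℕtoℚ (comp Q) ≤ δ * ℕtoℚ (choose2 n) →
            c₃ δ ^ℚ n < ℕtoℚ (e Q))
        -- f⁻(n,δ)^(1/n) < c₄(δ)
        × (Σ (Poset n) λ Q → (ℕtoℚ (comp Q) ≤ δ * ℕtoℚ (choose2 n))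
            × (ℕtoℚ (e Q) < c₄ δ ^ℚ n))))
    -- c₃(δ) → ∞ as δ → 0
    × (∀ (M : ℚ) → Σ ℚ λ η → (0ℚ < η) ×
        (∀ (δ : ℚ) → 0ℚ < δ → δ < η → δ < 1ℚ → M < c₃ δ))
    -- c₄(δ) → 1 as δ → 1
    × (∀ (ε : ℚ) → 0ℚ < ε → Σ ℚ λ η → (0ℚ < η) ×
        (∀ (δ : ℚ) → 0ℚ < δ → 1ℚ - η < δ → δ < 1ℚ → c₄ δ < 1ℚ + ε)))
theorem1p1 =
  ( c₁ , c₂
  , (λ δ 0<δ δ<1 → let open Bounds δ 0<δ δ<1 in
      0<c₁ , c₁<c₂ , c₂<1 , N⁺ , λ n n≥N → f⁺-lower n n≥N , f⁺-upper n n≥N)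
  , c₁→1 , c₂→0 )
  ,
  ( c₃ , c₄
  , (λ δ 0<δ δ<1 → let open Bounds δ 0<δ δ<1 in
      1<c₃ , c₃<c₄ , N⁻ , λ n n≥N → f⁻-lower n n≥N , f⁻-upper n n≥N)
  , c₃→∞ , c₄→1 )
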